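{- Let $n\in\mathbf{N}$. For each $k$ with $0\le k<n$, the inner loop at $k$ of the combing algorithm defines a bijection, and the inner loop at $k$ of the uncombing algorithm defines the inverse bijection, between $\mathrm{Pathfam}(n,k+1)$ and $\mathrm{Pathfam}(n,k)$.
   Context: **Paths.** A Schröder-type path is a sequence $(p_0,\ldots,p_m)$ of points of $\mathbf{Z}\times\mathbf{Z}$, $m\in\mathbf{N}$, with each $p_{l+1}-p_l\in\{(0,+1),(-1,+1),(-1,0)\}$ (a horizontal, diagonal, vertical step respectively); its support is $\{p_0,\ldots,p_m\}$. Column $j$ is the set of points with second coordinate $j$. An $n$-family is an $n$-tuple $(P_0,\ldots,P_{n-1})$ with $P_i$ a Schröder-type path from $(i,0)$ to $(0,i)$. **Encoding.** $\mathrm{Pathfam}(n)$ is the set of pairs $(B,D)$ of matrices indexed by $[n]\times[n]$, $[n]=\{0,\ldots,n-1\}$, with $B$ strictly lower triangular with entries in $\{0,1\}$ and $D$ weakly lower triangular with entries in $\mathbf{N}$. An $n$-family is encoded by the pair $(B,D)\in\mathrm{Pathfam}(n)$ for which, for $j<i$, $B_{i,j}=0$ (resp. $1$) if the step of $P_i$ from column $j$ to column $j+1$ is horizontal (resp. diagonal), and, for $j\le i$, $D_{i,j}$ is the number of vertical steps of $P_i$ in column $j$. (So $(B,D)$ encodes an $n$-family if and only if $\sum_{j<i}B_{i,j}+\sum_{j\le i}D_{i,j}=i$ for all $i\in[n]$.) For $0\le k\le n$, $\mathrm{Pathfam}(n,k)$ is the subset of $\mathrm{Pathfam}(n)$ of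 pairs $(B,D)$ encoding $n$-families without any vertical steps in any non-final column before column $k$ (that is, $D_{i,j}=0$ whenever $0\le j<k$ and $j<i<n$) and for which the supports of the paths $P_k,\ldots,P_{n-1}$ are all pairwise disjoint. **Basic operations** (for $0\le k\le i<n-1$; "$\gets$" is assignment). untangle$(i,k)$: set $cur\gets0$, $d\gets0$. For $j$ from $0$ up to $k-1$: set $cur\gets cur+B[i+1,j]-B[i,j]$; if $cur>d$ then set $d\gets cur$, $B[i,j]\gets1$, $B[i+1,j]\gets0$. After the loop set $D[i,k]\gets D[i,k]-d$ and $D[i+1,k]\gets d$. cliffify$(i,k)$ (also uses an auxiliary integer array $h$): set $d\gets D[i+1,k]$ and $cur\gets h[i+1]-h[i]-1$; set $D[i+1,k]\gets0$, $D[i,k]\gets D[i,k]+d$; set $h[i+1]\gets h[i+1]-d$, $h[i]\gets h[i]+d$. Then for $j$ from $k-1$ down to $0$: set $cur\gets cur+B[i+1,j]-B[i,j]$; if $cur<d$ then set $d\gets cur$, $B[i,j]\gets0$, $B[i+1,j]\gets1$. **Inner loops.** The inner loop at $k$ of the combing algorithm is: for $i$ from $k$ up to $n-2$ execute untangle$(i,k)$. (In the full algorithm it is preceded by $D[k,k]\gets k-\sum_{0\le j<k}B[k,j]$, which changes nothing for elements of $\mathrm{Pathfam}(n,k+1)$.) The inner loop at $k$ of the uncombing algorithm is: for $i$ from $n-1$ down to $k$: if $k=0$ set $h[i]\gets i$, otherwise set $h[i]\gets h[i]-B[i,k-1]$; then, if $i<n-1$, execute cliffify$(i,k)$. When $k>0$,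 it is assumed that $h[i]=i-\sum_{j=0}^{k-2}B_{i,j}$ for all $k\le i<n$ at the start of this loop (as results from the earlier loops at $0,\ldots,k-1$). -}

module Defs where

open import Data.Bool using (if_then_else_)
open import Data.Fin as Fin using (Fin; toℕ; inject₁; lower₁)
open import Data.Integer using (ℤ; +_; 0ℤ; 1ℤ; -1ℤ; _+_; _-_; _≤_; _<?_; _≟_)
open import Data.List using (List; []; _∷_; allFin; filter; foldl; foldr; length; map; reverse)
open import Data.List.Membership.Propositional using (_∈_)
open import Data.Nat as ℕ using (ℕ; suc)
open import Data.Product using (Σ; Σ-syntax; _×_; _,_; proj₁; proj₂)
open import Data.Product.Properties using (≡-dec)
open import Data.Sum using (_⊎_)
open import Data.Vec as Vec using (Vec; _[_]%=_; _[_]≔_)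
open import Level using (0ℓ)
open import Relation.Binary.Bundles using (Setoid)
open import Relation.Binary.Construct.Closure.ReflexiveTransitive using (Star; ε; _◅_)
import Relation.Binary.Construct.On as On
open import Relation.Binary.Definitions using (DecidableEquality)
open import Relation.Binary.PropositionalEquality using (_≡_; _≢_; refl; setoid)
open import Relation.Nullary using (¬_; yes; no; does)

Point : Set
Point = ℤ × ℤ

column : Point → ℤ
column = proj₂

data Kind : Set where
  horizontal diagonal vertical : Kind

_≟ᴷ_ : DecidableEquality Kind
horizontal ≟ᴷ horizontal = yes refl
horizontal ≟ᴷ diagonal   = no λ ()
horizontal ≟ᴷ vertical   = no λ ()
diagonal   ≟ᴷ horizontal = no λ ()
diagonal   ≟ᴷ diagonal   = yes refl
diagonal   ≟ᴷ vertical   = no λ ()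
vertical   ≟ᴷ horizontal = no λ ()
vertical   ≟ᴷ diagonal   = no λ ()
vertical   ≟ᴷ vertical   = yes refl

displacement : Kind → Point
displacement horizontal = 0ℤ  , 1ℤ
displacement diagonal   = -1ℤ , 1ℤ
displacement vertical   = -1ℤ , 0ℤ

_⊖_ : Point → Point → Point
(a , b) ⊖ (c , d) = a - c , b - d

Step : Point → Point → Set
Step p q = Σ[ s ∈ Kind ] q ⊖ p ≡ displacement s

Path : Point → Point → Set
Path = Star Step

support : ∀ {p q} → Path p q → List Point
support {p} ε       = p ∷ []
support {p} (_ ◅ P) = p ∷ support P

-- Each step is recorded as its kind together with the column it starts from.
steps : ∀ {p q} → Path p q → List (Kind × ℤ)
steps ε                 = []
steps {p} ((s , _) ◅ P) = (s , column p) ∷ steps P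

verticalSteps : ∀ {p q} → Path p q → ℤ → ℕ
verticalSteps P j = length (filter (≡-dec _≟ᴷ_ _≟_ (vertical , j)) (steps P))

Family : ℕ → Set
Family n = (i : Fin n) → Path (+ toℕ i , 0ℤ) (0ℤ , + toℕ i)

-- Matrices have integer entries, so that the subtractions in the algorithms
-- are not truncated; the ranges {0,1} and ℕ of the entries are part of Pathfam.

Matrix : ℕ → Set
Matrix n = Vec (Vec ℤ n) n

infixl 8 _⟨_,_⟩
_⟨_,_⟩ : ∀ {n} → Matrix n → Fin n → Fin n → ℤ
M ⟨ i , j ⟩ = Vec.lookup (Vec.lookup M i) j

infixl 6 _⟨_,_⟩≔_
_⟨_,_⟩≔_ : ∀ {n} → Matrix n → Fin n → Fin n → ℤ → Matrix n
M ⟨ i , j ⟩≔ x = M [ i ]%= (_[ j ]≔ x)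

Pair : ℕ → Set
Pair n = Matrix n × Matrix n

record Pathfam (n : ℕ) (BD : Pair n) : Set where
  private
    B = proj₁ BD
    D = proj₂ BD
  field
    B-strictlyLower : ∀ i j → i Fin.≤ j → B ⟨ i , j ⟩ ≡ 0ℤ
    B-binary        : ∀ i j → B ⟨ i , j ⟩ ≡ 0ℤ ⊎ B ⟨ i , j ⟩ ≡ 1ℤ
    D-weaklyLower   : ∀ i j → i Fin.< j → D ⟨ i , j ⟩ ≡ 0ℤ
    D-natural       : ∀ i j → 0ℤ ≤ D ⟨ i , j ⟩

-- P i has exactly one step from column j to column j+1 when j < i, and it is
-- horizontal or diagonal; hence the disjunction in B-entries is exclusive.
record Encodes {n : ℕ} (P : Family n) (BD : Pair n) : Set where
  private
    B = proj₁ BD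
    D = proj₂ BD
  field
    B-entries : ∀ i j → j Fin.< i →
      ((horizontal , + toℕ j) ∈ steps (P i) × B ⟨ i , j ⟩ ≡ 0ℤ) ⊎
      ((diagonal   , + toℕ j) ∈ steps (P i) × B ⟨ i , j ⟩ ≡ 1ℤ)
    D-entries : ∀ i j → j Fin.≤ i →
      D ⟨ i , j ⟩ ≡ + verticalSteps (P i) (+ toℕ j)

record Pathfamₖ (n k : ℕ) (BD : Pair n) : Set where
  field
    pathfam    : Pathfam n BD
    family     : Family n
    encodes    : Encodes family BD
    noVertical : ∀ i j → toℕ j ℕ.< k → j Fin.< i → proj₂ BD ⟨ i , j ⟩ ≡ 0ℤ
    disjoint   : ∀ i i′ → k ℕ.≤ toℕ i → k ℕ.≤ toℕ i′ → i ≢ i′ →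
                 ∀ p → ¬ (p ∈ support (family i) × p ∈ support (family i′))

-- The set Pathfam(n,k): elements are equal when their matrices are, whatever
-- the evidence for membership.
PathfamSetoid : (n k : ℕ) → Setoid 0ℓ 0ℓ
PathfamSetoid n k = On.setoid {B = Σ (Pair n) (Pathfamₖ n k)} (setoid (Pair n)) proj₁

for : {A S : Set} → List A → (A → S → S) → S → S
for xs body s₀ = foldl (λ s x → body x s) s₀ xs

-- Both ranges are listed in increasing order.
below : ∀ {n} → ℕ → List (Fin n)
below {n} k = filter (λ j → toℕ j ℕ.<? k) (allFin n)

from : ∀ {n} → ℕ → List (Fin n)
from {n} k = filter (λ i → k ℕ.≤? toℕ i) (allFin n)

-- In both basic operations n = suc m and the row index i < n-1 is given as
-- i : Fin m, so that rows i and i+1 are inject₁ i and Fin.suc i.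

untangle : ∀ {m} → Fin m → Fin (suc m) → Pair (suc m) → Pair (suc m)
untangle {m} i k (B₀ , D₀) = finish (for (below (toℕ k)) body (0ℤ , 0ℤ , B₀))
  where
  r r⁺ : Fin (suc m)
  r  = inject₁ i
  r⁺ = Fin.suc i

  -- (cur , d , B)
  body : Fin (suc m) → ℤ × ℤ × Matrix (suc m) → ℤ × ℤ × Matrix (suc m)
  body j (cur , d , B) =
    let cur′ = cur + B ⟨ r⁺ , j ⟩ - B ⟨ r , j ⟩ in
    if does (d <? cur′)
    then (cur′ , cur′ , (B ⟨ r , j ⟩≔ 1ℤ ⟨ r⁺ , j ⟩≔ 0ℤ))
    else (cur′ , d , B)

  finish : ℤ × ℤ × Matrix (suc m) → Pair (suc m)
  finish (_ , d , B) = B , (D₀ ⟨ r , k ⟩≔ (D₀ ⟨ r , k ⟩ - d) ⟨ r⁺ , k ⟩≔ d)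

cliffify : ∀ {m} → Fin m → Fin (suc m) →
           Pair (suc m) × Vec ℤ (suc m) → Pair (suc m) × Vec ℤ (suc m)
cliffify {m} i k ((B₀ , D₀) , h₀) = finish (for (reverse (below (toℕ k))) body (cur₀ , d₀ , B₀))
  where
  r r⁺ : Fin (suc m)
  r  = inject₁ i
  r⁺ = Fin.suc i

  d₀ cur₀ : ℤ
  d₀   = D₀ ⟨ r⁺ , k ⟩
  cur₀ = Vec.lookup h₀ r⁺ - Vec.lookup h₀ r - 1ℤ

  D₁ : Matrix (suc m)
  D₁ = D₀ ⟨ r⁺ , k ⟩≔ 0ℤ ⟨ r , k ⟩≔ (D₀ ⟨ r , k ⟩ + d₀)

  h₁ : Vec ℤ (suc m)
  h₁ = h₀ [ r⁺ ]≔ (Vec.lookup h₀ r⁺ - d₀) [ r ]≔ (Vec.lookup h₀ r + d₀)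

  -- (cur , d , B)
  body : Fin (suc m) → ℤ × ℤ × Matrix (suc m) → ℤ × ℤ × Matrix (suc m)
  body j (cur , d , B) =
    let cur′ = cur + B ⟨ r⁺ , j ⟩ - B ⟨ r , j ⟩ in
    if does (cur′ <? d)
    then (cur′ , cur′ , (B ⟨ r , j ⟩≔ 0ℤ ⟨ r⁺ , j ⟩≔ 1ℤ))
    else (cur′ , d , B)

  finish : ℤ × ℤ × Matrix (suc m) → Pair (suc m) × Vec ℤ (suc m)
  finish (_ , _ , B) = (B , D₁) , h₁

combLoop : ∀ {n} → Fin n → Pair n → Pair n
combLoop {suc m} k = for (from (toℕ k)) (λ i → untangle {m} i k)

updateHeight : ∀ {m} → Fin (suc m) → Fin (suc m) → Matrix (suc m) → Vec ℤ (suc m) → Vec ℤ (suc m)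
updateHeight i Fin.zero    B h = h [ i ]≔ + toℕ i
updateHeight i (Fin.suc l) B h = h [ i ]≔ (Vec.lookup h i - B ⟨ i , inject₁ l ⟩)

uncombBody : ∀ {m} → Fin (suc m) → Fin (suc m) →
             Pair (suc m) × Vec ℤ (suc m) → Pair (suc m) × Vec ℤ (suc m)
uncombBody {m} k i ((B , D) , h) with m ℕ.≟ toℕ i
... | yes _    = (B , D) , updateHeight i k B h
... | no m≢i  = cliffify (lower₁ i m≢i) k ((B , D) , updateHeight i k B h)

uncombLoop : ∀ {n} → Fin n → Pair n × Vec ℤ n → Pair n × Vec ℤ n
uncombLoop {suc m} k = for (reverse (from (toℕ k))) (uncombBody k)

sumOver : {A : Set} → List A → (A → ℤ) → ℤ
sumOver xs f = foldr _+_ 0ℤ (map f xs)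

-- The assumption on h at the start of the uncombing loop at k. The other
-- entries of h, and all of them when k = 0, are unconstrained.
InitialHeights : ∀ {n} → Fin n → Pair n → Vec ℤ n → Set
InitialHeights k (B , _) h =
  0 ℕ.< toℕ k → ∀ i → k Fin.≤ i →
  Vec.lookup h i ≡ + toℕ i - sumOver (below (toℕ k ℕ.∸ 1)) (λ j → B ⟨ i , j ⟩)

{-# OPTIONS --safe #-}
-- Let X_i(j) be the number of diagonal steps of P_i before column j. Untangling rows i and i+1 is
-- Pitman's transformation: if M_i is the running maximum of X_{i+1} - X_i (and of 0), it adds M_i to X_i
-- and subtracts M_i from X_{i+1}. Cliffifying recovers M_i from the result as a future minimum of
-- X_i - X_{i+1}, capped by the number M_i(k) of vertical steps of P_{i+1} in column k. Since P_{i+1} and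
-- P_{i+2} were disjoint before P_{i+1} was raised by M_i, one has M_{i+1} ≤ M_i. Hence untangling rows
-- i+1 and i+2 cannot make P_{i+1} meet P_i again, and it removes at most the M_i(k) vertical steps that
-- P_{i+1} has just gained.
module Submission where

open import Defs
open import Data.Bool using (true; false; if_then_else_)
open import Data.Fin as Fin using (Fin; toℕ; inject₁; fromℕ; fromℕ<)
open import Data.Fin.Properties using (toℕ-inject₁; toℕ-inject₁-≢; lower₁-inject₁′; toℕ-fromℕ; toℕ-fromℕ<; toℕ<n; toℕ-injective)
open import Data.Integer using (ℤ; +_; 0ℤ; 1ℤ; -1ℤ; _+_; _-_; -_; _≤_; _<_; _<?_; _≟_; ∣_∣; +≤+)
import Data.Integer.Properties as ℤ
open import Data.Integer.Tactic.RingSolver using (solve)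
open import Data.List using (List; []; _∷_; _∷ʳ_; allFin; filter; length; map; reverse)
open import Data.List.Membership.Propositional using (_∈_)
import Data.List.Properties as List
import Data.List.Relation.Unary.All as All
open import Data.List.Relation.Unary.Any using (here; there)
open import Data.Nat as ℕ using (ℕ; zero; suc; z≤n; s≤s)
import Data.Nat.Properties as ℕ
open import Data.Product using (Σ-syntax; ∃-syntax; _×_; _,_; proj₁; proj₂; map₁)
open import Data.Product.Properties using (≡-dec)
open import Data.Sum using (_⊎_; inj₁; inj₂)
open import Data.Vec as Vec using (Vec; _[_]≔_)
open import Function using (_∘_)
open import Function.Bundles using (Inverse)
open import Level using (0ℓ)
open import Relation.Binary.Construct.Closure.ReflexiveTransitive using (ε; _◅_)
open import Relation.Binary.Definitions using (tri<; tri≈; tri>)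
open import Relation.Binary.PropositionalEquality
open import Relation.Nullary using (¬_; yes; no; does; contradiction)
open import Relation.Unary using (Pred; Decidable)
open import Algebra.Properties.AbelianGroup ℤ.+-0-abelianGroup using () renaming (∙-cancelʳ to +-cancelʳ)

-- Linear inequalities

-- Both algorithms are compared through one relation, `Untangled`, that holds between a pair before
-- and after an untangling and does not say which of the two was computed. Either side determines
-- the other: M can be rebuilt from the left since it starts at 0, and from the right since its last
-- value survives as the number of vertical steps of row i+1 in column k. Each loop yields a `Chain`
-- of such relations, and the inverse laws follow without any computation. The obstacle is that
-- `untangle` and `cliffify` are inverse only under conditions on the two rows, and these must be
-- known for intermediate pairs as well, where the rows are ordered only in part. One `Invariant`
-- provides them in both directions. Its N is forced to satisfy M_i ≤ N ≤ M_{i-1}; combing takes N =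
-- M_{i-1} and uncombing N = M_i. At the two ends of the loop, where one of these is missing, N
-- counts the horizontal steps of P_k, or is 0.

≤-by₀ : ∀ {c d} → 0ℤ ≤ d - c → c ≤ d
≤-by₀ = ℤ.0≤i-j⇒j≤i

-- Once `d - c` is expressed by the differences of known inequalities, a linear inequality becomes a
-- ring identity. The local lemmas called `eq` state such identities for variables, as `solve`
-- requires, and absorb side equations by matching on `refl`.
≤-by₁ : ∀ {a b c d} → a ≤ b → d - c ≡ b - a → c ≤ d
≤-by₁ p eq = ≤-by₀ (subst (0ℤ ≤_) (sym eq) (ℤ.i≤j⇒0≤j-i p))

≤-by₂ : ∀ {a b a′ b′ c d} → a ≤ b → a′ ≤ b′ → d - c ≡ (b - a) + (b′ - a′) → c ≤ d
≤-by₂ p q eq = ≤-by₀ (subst (0ℤ ≤_) (sym eq) (ℤ.+-mono-≤ (ℤ.i≤j⇒0≤j-i p) (ℤ.i≤j⇒0≤j-i q)))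

0≤1 : 0ℤ ≤ 1ℤ
0≤1 = +≤+ z≤n

1+≰ : ∀ {a} → ¬ a + 1ℤ ≤ a
1+≰ {a} p = contradiction (≤-by₁ {c = 1ℤ} {d = 0ℤ} p (solve (a ∷ []))) λ { (+≤+ ()) }

<⇒+1≤ : ∀ {a b} → a < b → a + 1ℤ ≤ b
<⇒+1≤ {a} p = subst (_≤ _) (ℤ.+-comm 1ℤ a) (ℤ.i<j⇒suc[i]≤j p)

+suc : ∀ n → + suc n ≡ + n + 1ℤ
+suc n = cong +_ (sym (ℕ.+-comm n 1))

-- Loops

for-∷ʳ : ∀ {A S : Set} (xs : List A) x (body : A → S → S) s →
         for (xs ∷ʳ x) body s ≡ body x (for xs body s)
for-∷ʳ xs x body s = List.foldl-∷ʳ (λ s x → body x s) s x xs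

reverse-∷ʳ : ∀ {A : Set} (xs : List A) x → reverse (xs ∷ʳ x) ≡ x ∷ reverse xs
reverse-∷ʳ xs x = List.reverse-++ xs (x ∷ [])

filter-map : ∀ {A B : Set} {P : Pred B 0ℓ} (P? : Decidable P) (f : A → B) xs →
             filter P? (map f xs) ≡ map f (filter (P? ∘ f) xs)
filter-map P? f []       = refl
filter-map P? f (x ∷ xs) with does (P? (f x)) | filter-map P? f xs
... | true  | ih = cong (f x ∷_) ih
... | false | ih = ih

allFin-suc : ∀ n → allFin (suc n) ≡ Fin.zero ∷ map Fin.suc (allFin n)
allFin-suc n = cong (Fin.zero ∷_) (sym (List.map-tabulate (λ i → i) Fin.suc))

below-zero : ∀ n → below {n} 0 ≡ []
below-zero n = List.filter-none (λ j → toℕ j ℕ.<? 0) (All.universal (λ _ ()) (allFin n))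

below-suc : ∀ n k → below {suc n} (suc k) ≡ Fin.zero ∷ map Fin.suc (below {n} k)
below-suc n k = begin
  filter (λ j → toℕ j ℕ.<? suc k) (allFin (suc n))
    ≡⟨ cong (filter (λ j → toℕ j ℕ.<? suc k)) (allFin-suc n) ⟩
  Fin.zero ∷ filter (λ j → toℕ j ℕ.<? suc k) (map Fin.suc (allFin n))
    ≡⟨ cong (Fin.zero ∷_) (filter-map (λ j → toℕ j ℕ.<? suc k) Fin.suc (allFin n)) ⟩
  Fin.zero ∷ map Fin.suc (filter (λ j → suc (toℕ j) ℕ.<? suc k) (allFin n))
    ≡⟨ cong (λ l → Fin.zero ∷ map Fin.suc l)
         (List.filter-≐ (λ j → suc (toℕ j) ℕ.<? suc k) (λ j → toℕ j ℕ.<? k)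
           (ℕ.s≤s⁻¹ , s≤s) (allFin n)) ⟩
  Fin.zero ∷ map Fin.suc (below k) ∎
  where open ≡-Reasoning

below-∷ʳ : ∀ {n} (j : Fin n) → below (suc (toℕ j)) ≡ below (toℕ j) ∷ʳ j
below-∷ʳ {suc n} Fin.zero = begin
  below 1                           ≡⟨ below-suc n 0 ⟩
  Fin.zero ∷ map Fin.suc (below 0)  ≡⟨ cong (λ l → Fin.zero ∷ map Fin.suc l) (below-zero n) ⟩
  Fin.zero ∷ []                     ≡⟨ cong (_∷ʳ Fin.zero) (below-zero (suc n)) ⟨
  below 0 ∷ʳ Fin.zero               ∎
  where open ≡-Reasoning
below-∷ʳ {suc n} (Fin.suc j) = begin
  below (suc (suc (toℕ j)))                          ≡⟨ below-suc n (suc (toℕ j)) ⟩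
  Fin.zero ∷ map Fin.suc (below (suc (toℕ j)))       ≡⟨ cong (λ l → Fin.zero ∷ map Fin.suc l) (below-∷ʳ j) ⟩
  Fin.zero ∷ map Fin.suc (below (toℕ j) ∷ʳ j)        ≡⟨ cong (Fin.zero ∷_) (List.map-++ Fin.suc (below (toℕ j)) (j ∷ [])) ⟩
  Fin.zero ∷ map Fin.suc (below (toℕ j)) ∷ʳ Fin.suc j ≡⟨ cong (_∷ʳ Fin.suc j) (below-suc n (toℕ j)) ⟨
  below (suc (toℕ j)) ∷ʳ Fin.suc j                   ∎
  where open ≡-Reasoning

from-zero : ∀ n → from {suc n} 0 ≡ Fin.zero ∷ map Fin.suc (from {n} 0)
from-zero n = begin
  from {suc n} 0                      ≡⟨ all-from (suc n) ⟩
  allFin (suc n)                      ≡⟨ allFin-suc n ⟩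
  Fin.zero ∷ map Fin.suc (allFin n)   ≡⟨ cong (λ l → Fin.zero ∷ map Fin.suc l) (all-from n) ⟨
  Fin.zero ∷ map Fin.suc (from 0)     ∎
  where
  open ≡-Reasoning
  all-from : ∀ n → from {n} 0 ≡ allFin n
  all-from n = List.filter-all (λ i → 0 ℕ.≤? toℕ i) (All.universal (λ _ → z≤n) (allFin n))

from-suc : ∀ n k → from {suc n} (suc k) ≡ map Fin.suc (from {n} k)
from-suc n k = begin
  filter (λ i → suc k ℕ.≤? toℕ i) (allFin (suc n))
    ≡⟨ cong (filter (λ i → suc k ℕ.≤? toℕ i)) (allFin-suc n) ⟩
  filter (λ i → suc k ℕ.≤? toℕ i) (map Fin.suc (allFin n))
    ≡⟨ filter-map (λ i → suc k ℕ.≤? toℕ i) Fin.suc (allFin n) ⟩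
  map Fin.suc (filter (λ i → suc k ℕ.≤? suc (toℕ i)) (allFin n))
    ≡⟨ cong (map Fin.suc)
         (List.filter-≐ (λ i → suc k ℕ.≤? suc (toℕ i)) (λ i → k ℕ.≤? toℕ i)
           (ℕ.s≤s⁻¹ , s≤s) (allFin n)) ⟩
  map Fin.suc (from k) ∎
  where open ≡-Reasoning

from-∷ : ∀ {n} (i : Fin n) → from (toℕ i) ≡ i ∷ from (suc (toℕ i))
from-∷ {suc n} Fin.zero    = trans (from-zero n) (cong (Fin.zero ∷_) (sym (from-suc n 0)))
from-∷ {suc n} (Fin.suc i) = begin
  from (suc (toℕ i))                           ≡⟨ from-suc n (toℕ i) ⟩
  map Fin.suc (from (toℕ i))                   ≡⟨ cong (map Fin.suc) (from-∷ i) ⟩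
  Fin.suc i ∷ map Fin.suc (from (suc (toℕ i))) ≡⟨ cong (Fin.suc i ∷_) (from-suc n (suc (toℕ i))) ⟨
  Fin.suc i ∷ from (suc (suc (toℕ i)))         ∎
  where open ≡-Reasoning

from-end : ∀ n → from {n} n ≡ []
from-end zero    = refl
from-end (suc n) = trans (from-suc n n) (cong (map Fin.suc) (from-end n))

-- Entries indexed by natural numbers

at : ∀ {n} → Vec ℤ n → ℕ → ℤ
at Vec.[]       _       = 0ℤ
at (x Vec.∷ xs) zero    = x
at (x Vec.∷ xs) (suc j) = at xs j

at-lookup : ∀ {n} (v : Vec ℤ n) j → at v (toℕ j) ≡ Vec.lookup v j
at-lookup (x Vec.∷ v) Fin.zero    = refl
at-lookup (x Vec.∷ v) (Fin.suc j) = at-lookup v j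

at-≔ : ∀ {n} (v : Vec ℤ n) j x → at (v [ j ]≔ x) (toℕ j) ≡ x
at-≔ (_ Vec.∷ v) Fin.zero    x = refl
at-≔ (_ Vec.∷ v) (Fin.suc j) x = at-≔ v j x

at-≔-other : ∀ {n} (v : Vec ℤ n) j x {l} → l ≢ toℕ j → at (v [ j ]≔ x) l ≡ at v l
at-≔-other (_ Vec.∷ v) Fin.zero    x {zero}  l≢j = contradiction refl l≢j
at-≔-other (_ Vec.∷ v) Fin.zero    x {suc l} l≢j = refl
at-≔-other (_ Vec.∷ v) (Fin.suc j) x {zero}  l≢j = refl
at-≔-other (_ Vec.∷ v) (Fin.suc j) x {suc l} l≢j = at-≔-other v j x (l≢j ∘ cong suc)

-- The rows and columns outside the matrix are zero.
entry : ∀ {m n} → Vec (Vec ℤ n) m → ℕ → ℕ → ℤ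
entry Vec.[]      _       _ = 0ℤ
entry (v Vec.∷ M) zero    j = at v j
entry (v Vec.∷ M) (suc i) j = entry M i j

entry-row : ∀ {m n} (M : Vec (Vec ℤ n) m) i j → entry M (toℕ i) j ≡ at (Vec.lookup M i) j
entry-row (v Vec.∷ M) Fin.zero    j = refl
entry-row (v Vec.∷ M) (Fin.suc i) j = entry-row M i j

entry-lookup : ∀ {n} (M : Matrix n) i j → entry M (toℕ i) (toℕ j) ≡ M ⟨ i , j ⟩
entry-lookup M i j = trans (entry-row M i (toℕ j)) (at-lookup (Vec.lookup M i) j)

entry-%=-other : ∀ {m n} (M : Vec (Vec ℤ n) m) i f {r} j → r ≢ toℕ i →
                 entry (M Vec.[ i ]%= f) r j ≡ entry M r j
entry-%=-other (v Vec.∷ M) Fin.zero    f {zero}  j r≢i = contradiction refl r≢i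
entry-%=-other (v Vec.∷ M) Fin.zero    f {suc r} j r≢i = refl
entry-%=-other (v Vec.∷ M) (Fin.suc i) f {zero}  j r≢i = refl
entry-%=-other (v Vec.∷ M) (Fin.suc i) f {suc r} j r≢i = entry-%=-other M i f j (r≢i ∘ cong suc)

entry-%= : ∀ {m n} (M : Vec (Vec ℤ n) m) i f j →
           entry (M Vec.[ i ]%= f) (toℕ i) j ≡ at (f (Vec.lookup M i)) j
entry-%= (v Vec.∷ M) Fin.zero    f j = refl
entry-%= (v Vec.∷ M) (Fin.suc i) f j = entry-%= M i f j

entry-≔ : ∀ {n} (M : Matrix n) i j x → entry (M ⟨ i , j ⟩≔ x) (toℕ i) (toℕ j) ≡ x
entry-≔ M i j x = trans (entry-%= M i (_[ j ]≔ x) (toℕ j)) (at-≔ (Vec.lookup M i) j x)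

entry-≔-other : ∀ {n} (M : Matrix n) i j x {r c} → r ≢ toℕ i ⊎ c ≢ toℕ j →
                entry (M ⟨ i , j ⟩≔ x) r c ≡ entry M r c
entry-≔-other M i j x {r} {c} (inj₁ r≢i) = entry-%=-other M i (_[ j ]≔ x) c r≢i
entry-≔-other M i j x {r} {c} (inj₂ c≢j) with r ℕ.≟ toℕ i
... | no r≢i   = entry-%=-other M i (_[ j ]≔ x) c r≢i
... | yes refl = begin
  entry (M ⟨ i , j ⟩≔ x) (toℕ i) c      ≡⟨ entry-%= M i (_[ j ]≔ x) c ⟩
  at (Vec.lookup M i [ j ]≔ x) c        ≡⟨ at-≔-other (Vec.lookup M i) j x c≢j ⟩
  at (Vec.lookup M i) c                 ≡⟨ entry-row M i c ⟨
  entry M (toℕ i) c                     ∎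
  where open ≡-Reasoning

at-ext : ∀ {n} (v w : Vec ℤ n) → (∀ j → at v j ≡ at w j) → v ≡ w
at-ext Vec.[]      Vec.[]      eq = refl
at-ext (x Vec.∷ v) (y Vec.∷ w) eq = cong₂ Vec._∷_ (eq 0) (at-ext v w (eq ∘ suc))

entry-ext : ∀ {m n} (M N : Vec (Vec ℤ n) m) → (∀ i j → entry M i j ≡ entry N i j) → M ≡ N
entry-ext Vec.[]      Vec.[]      eq = refl
entry-ext (v Vec.∷ M) (w Vec.∷ N) eq = cong₂ Vec._∷_ (at-ext v w (eq 0)) (entry-ext M N (eq ∘ suc))

entry-outside : ∀ {a c} (M : Vec (Vec ℤ c) a) r j → a ℕ.≤ r → entry M r j ≡ 0ℤ
entry-outside Vec.[]      r       j _   = refl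
entry-outside (v Vec.∷ M) (suc r) j a≤r = entry-outside M r j (ℕ.s≤s⁻¹ a≤r)

at-all : ∀ {n} (v : Vec ℤ n) (P : ℕ → ℤ → Set) → (∀ j → P j 0ℤ) →
         (∀ j → P (toℕ j) (Vec.lookup v j)) → ∀ j → P j (at v j)
at-all Vec.[]      P zeros all j       = zeros j
at-all (x Vec.∷ v) P zeros all zero    = all Fin.zero
at-all (x Vec.∷ v) P zeros all (suc j) = at-all v (P ∘ suc) (zeros ∘ suc) (all ∘ Fin.suc) j

entry-all : ∀ {m n} (M : Vec (Vec ℤ n) m) (P : ℕ → ℕ → ℤ → Set) → (∀ r j → P r j 0ℤ) →
            (∀ r j → P (toℕ r) (toℕ j) (Vec.lookup (Vec.lookup M r) j)) → ∀ r j → P r j (entry M r j)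
entry-all Vec.[]      P zeros all r       j = zeros r j
entry-all (v Vec.∷ M) P zeros all zero    j = at-all v (P 0) (zeros 0) (all Fin.zero) j
entry-all (v Vec.∷ M) P zeros all (suc r) j = entry-all M (P ∘ suc) (zeros ∘ suc) (all ∘ Fin.suc) r j

-- Prefix sums

prefix : (ℕ → ℤ) → ℕ → ℤ
prefix f zero    = 0ℤ
prefix f (suc j) = prefix f j + f j

-- A change of terms before `a` that keeps the sum up to `a` is invisible afterwards. With `a` equal
-- to k+1 this shows that untangling at k leaves the paths in place beyond column k.
prefix-agree : ∀ {f g a} → prefix f a ≡ prefix g a → ∀ {j} → a ℕ.≤ j →
               (∀ l → a ℕ.≤ l → l ℕ.< j → f l ≡ g l) → prefix f j ≡ prefix g j
prefix-agree {f} {g} {a} eq {j} a≤j f≡g with a ℕ.≟ j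
... | yes refl = eq
prefix-agree {f} {g} {a} eq {zero}  a≤0 f≡g | no a≢0 = contradiction (ℕ.n≤0⇒n≡0 a≤0) a≢0
prefix-agree {f} {g} {a} eq {suc j} a≤j f≡g | no a≢j =
  cong₂ _+_ (prefix-agree eq a≤j′ (λ l a≤l l<j → f≡g l a≤l (ℕ.m<n⇒m<1+n l<j)))
            (f≡g j a≤j′ ℕ.≤-refl)
  where a≤j′ = ℕ.s≤s⁻¹ (ℕ.≤∧≢⇒< a≤j a≢j)

prefix-cong : ∀ {f g} j → (∀ l → l ℕ.< j → f l ≡ g l) → prefix f j ≡ prefix g j
prefix-cong j f≡g = prefix-agree {a = 0} refl z≤n (λ l _ → f≡g l)

sumOver-below : ∀ {n} (f : Fin n → ℤ) (g : ℕ → ℤ) → (∀ j → f j ≡ g (toℕ j)) →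
                ∀ j → j ℕ.≤ n → sumOver (below j) f ≡ prefix g j
sumOver-below {n} f g f≡g zero    _   = cong (λ l → sumOver l f) (below-zero n)
sumOver-below {n} f g f≡g (suc j) j<n = begin
  sumOver (below (suc j)) f         ≡⟨ cong (λ i → sumOver (below (suc i)) f) (toℕ-fromℕ< j<n) ⟨
  sumOver (below (suc (toℕ c))) f   ≡⟨ cong (λ l → sumOver l f) (below-∷ʳ c) ⟩
  sumOver (below (toℕ c) ∷ʳ c) f    ≡⟨ sumOver-∷ʳ (below (toℕ c)) c ⟩
  sumOver (below (toℕ c)) f + f c   ≡⟨ cong₂ _+_ (cong (λ i → sumOver (below i) f) (toℕ-fromℕ< j<n))
                                         (trans (f≡g c) (cong g (toℕ-fromℕ< j<n))) ⟩
  sumOver (below j) f + g j         ≡⟨ cong (_+ g j) (sumOver-below f g f≡g j (ℕ.<⇒≤ j<n)) ⟩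
  prefix g j + g j                  ∎
  where
  open ≡-Reasoning
  c = Fin.fromℕ< j<n
  sumOver-∷ʳ : ∀ xs x → sumOver (xs ∷ʳ x) f ≡ sumOver xs f + f x
  sumOver-∷ʳ []       x = trans (ℤ.+-identityʳ (f x)) (sym (ℤ.+-identityˡ (f x)))
  sumOver-∷ʳ (y ∷ xs) x = trans (cong (λ z → f y + z) (sumOver-∷ʳ xs x)) (sym (ℤ.+-assoc (f y) _ (f x)))

-- The effect of untangling two rows

Entries : Set
Entries = ℕ → ℕ → ℤ

excess : Entries → ℕ → ℕ → ℤ
excess b i j = prefix (b (suc i)) j - prefix (b i) j

-- M is meant to be the running maximum of e.
data Column (b b′ : Entries) (e M : ℕ → ℤ) (i j : ℕ) : Set where
  swap : b i j ≡ 0ℤ → b (suc i) j ≡ 1ℤ → b′ i j ≡ 1ℤ → b′ (suc i) j ≡ 0ℤ →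
         M (suc j) ≡ M j + 1ℤ → e (suc j) ≡ M (suc j) → Column b b′ e M i j
  stay : b′ i j ≡ b i j → b′ (suc i) j ≡ b (suc i) j →
         M (suc j) ≡ M j → e (suc j) ≤ M j → Column b b′ e M i j

OtherRow : ℕ → ℕ → Set
OtherRow i r = r ≢ i × r ≢ suc i

-- A relation rather than a function, so that `untangle` can be shown to lead from s to s′ and
-- `cliffify` from s′ to s. The condition `d-lower` on s makes this reversible: the entry that
-- receives M k held no information before.
record Untangled {n} (k i : ℕ) (s s′ : Pair n) : Set where
  b = entry (proj₁ s)
  d = entry (proj₂ s)
  b′ = entry (proj₁ s′)
  d′ = entry (proj₂ s′)
  field
    M       : ℕ → ℤ
    M-zero  : M 0 ≡ 0ℤ
    columns : ∀ j → j ℕ.< k → Column b b′ (excess b i) M i j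
    same-b  : ∀ r j → OtherRow i r ⊎ k ℕ.≤ j → b′ r j ≡ b r j
    d-upper : d′ i k ≡ d i k - M k
    d-lower : d (suc i) k ≡ 0ℤ
    d-moved : d′ (suc i) k ≡ M k
    same-d  : ∀ r j → OtherRow i r ⊎ j ≢ k → d′ r j ≡ d r j

module _ {b b′ : Entries} {e M : ℕ → ℤ} {i k : ℕ}
         (M-zero : M 0 ≡ 0ℤ) (columns : ∀ j → j ℕ.< k → Column b b′ e M i j) where

  -- Each `swap` moves one diagonal step from row i+1 to row i and raises M by one. The function e
  -- is arbitrary because `cliffify` needs these sums in order to identify its e with the excess of
  -- its result.
  prefix-upper : ∀ j → j ℕ.≤ k → prefix (b′ i) j ≡ prefix (b i) j + M j
  prefix-upper zero    _   = sym (trans (ℤ.+-identityˡ (M 0)) M-zero)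
  prefix-upper (suc j) j<k with columns j j<k | prefix-upper j (ℕ.<⇒≤ j<k)
  ... | swap p _ q _ e _ | ih = eq (prefix (b i) j) (M j) ih p q e
    where
    eq : ∀ x m {x′ β β′ m′} → x′ ≡ x + m → β ≡ 0ℤ → β′ ≡ 1ℤ → m′ ≡ m + 1ℤ → x′ + β′ ≡ (x + β) + m′
    eq x m refl refl refl refl = solve (x ∷ m ∷ [])
  ... | stay q _ e _ | ih = eq (prefix (b i) j) (b i j) (M j) ih q e
    where
    eq : ∀ x β m {x′ β′ m′} → x′ ≡ x + m → β′ ≡ β → m′ ≡ m → x′ + β′ ≡ (x + β) + m′
    eq x β m refl refl refl = solve (x ∷ m ∷ β ∷ [])

  prefix-lower : ∀ j → j ℕ.≤ k → prefix (b′ (suc i)) j ≡ prefix (b (suc i)) j - M j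
  prefix-lower zero    _   = cong (λ z → 0ℤ - z) (sym M-zero)
  prefix-lower (suc j) j<k with columns j j<k | prefix-lower j (ℕ.<⇒≤ j<k)
  ... | swap _ p _ q e _ | ih = eq (prefix (b (suc i)) j) (M j) ih p q e
    where
    eq : ∀ x m {x′ β β′ m′} → x′ ≡ x - m → β ≡ 1ℤ → β′ ≡ 0ℤ → m′ ≡ m + 1ℤ → x′ + β′ ≡ (x + β) - m′
    eq x m refl refl refl refl = solve (x ∷ m ∷ [])
  ... | stay _ q e _ | ih = eq (prefix (b (suc i)) j) (b (suc i) j) (M j) ih q e
    where
    eq : ∀ x β m {x′ β′ m′} → x′ ≡ x - m → β′ ≡ β → m′ ≡ m → x′ + β′ ≡ (x + β) - m′
    eq x β m refl refl refl = solve (x ∷ m ∷ β ∷ [])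

  M-mono : ∀ j → j ℕ.< k → M j ≤ M (suc j)
  M-mono j j<k with columns j j<k
  ... | swap _ _ _ _ e _ = ≤-by₁ 0≤1 (eq (M j) e)
    where
    eq : ∀ m {m′} → m′ ≡ m + 1ℤ → m′ - m ≡ 1ℤ - 0ℤ
    eq m refl = solve (m ∷ [])
  ... | stay _ _ e _     = ℤ.≤-reflexive (sym e)

module _ {b b′ : Entries} {M : ℕ → ℤ} {i k : ℕ}
         (M-zero : M 0 ≡ 0ℤ) (columns : ∀ j → j ℕ.< k → Column b b′ (excess b i) M i j) where

  excess≤M : ∀ j → j ℕ.≤ k → excess b i j ≤ M j
  excess≤M zero    _   = ℤ.≤-reflexive (sym M-zero)
  excess≤M (suc j) j<k with columns j j<k
  ... | swap _ _ _ _ _ e = ℤ.≤-reflexive e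
  ... | stay _ _ e p     = subst (excess b i (suc j) ≤_) (sym e) p

  -- By the two prefix formulas the gap of the result is 2 M minus the excess of the source, and
  -- that excess is at most M.
  M≤gap : ∀ j → j ℕ.≤ k → prefix (b′ (suc i)) j + M j ≤ prefix (b′ i) j
  M≤gap j j≤k = ≤-by₁ (excess≤M j j≤k)
    (eq (prefix (b i) j) (prefix (b (suc i)) j) (M j) 
        (prefix-upper M-zero columns j j≤k) (prefix-lower M-zero columns j j≤k))
    where
    eq : ∀ x y m {x′ y′} → x′ ≡ x + m → y′ ≡ y - m → x′ - (y′ + m) ≡ m - (y - x)
    eq x y m refl refl = solve (x ∷ y ∷ m ∷ [])

-- A `swap` has excess M j + 1 after the column and a `stay` at most M j, so the source and M j
-- decide between them.
column-functional : ∀ {b b′ b″ e M N i j} → Column b b′ e M i j → Column b b″ e N i j → M j ≡ N j →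
                    b′ i j ≡ b″ i j × b′ (suc i) j ≡ b″ (suc i) j × M (suc j) ≡ N (suc j)
column-functional (swap _ _ p q e _) (swap _ _ p′ q′ e′ _) M≡N =
  trans p (sym p′) , trans q (sym q′) , trans e (trans (cong (_+ 1ℤ) M≡N) (sym e′))
column-functional (stay p q e _) (stay p′ q′ e′ _) M≡N =
  trans p (sym p′) , trans q (sym q′) , trans e (trans M≡N (sym e′))
column-functional (swap _ _ _ _ e x) (stay _ _ _ y) M≡N =
  contradiction (subst₂ _≤_ (trans x e) (sym M≡N) y) 1+≰
column-functional (stay _ _ _ y) (swap _ _ _ _ e x) M≡N =
  contradiction (subst₂ _≤_ (trans x e) M≡N y) 1+≰

-- If one of the columns were a swap and the other not, M j would exceed the
-- gap of the result, which the swap pins down to M (suc j) - 1.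
column-cofunctional :
  ∀ {a b b′ M N i j} → Column a b′ (excess a i) M i j → Column b b′ (excess b i) N i j →
  prefix (b′ i) (suc j) ≡ prefix (a i) (suc j) + M (suc j) →
  prefix (b′ (suc i)) (suc j) ≡ prefix (a (suc i)) (suc j) - M (suc j) →
  prefix (b′ i) (suc j) ≡ prefix (b i) (suc j) + N (suc j) →
  prefix (b′ (suc i)) (suc j) ≡ prefix (b (suc i)) (suc j) - N (suc j) →
  prefix (b′ (suc i)) j + M j ≤ prefix (b′ i) j →
  prefix (b′ (suc i)) j + N j ≤ prefix (b′ i) j →
  M (suc j) ≡ N (suc j) →
  a i j ≡ b i j × a (suc i) j ≡ b (suc i) j × M j ≡ N j
column-cofunctional {M = M} {N} {j = j} (swap p q _ _ e _) (swap p′ q′ _ _ e′ _) _ _ _ _ _ _ M≡N =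
  trans p (sym p′) , trans q (sym q′) , +-cancelʳ 1ℤ (M j) (N j) (trans (sym e) (trans M≡N e′))
column-cofunctional (stay p q e _) (stay p′ q′ e′ _) _ _ _ _ _ _ M≡N =
  trans (sym p) p′ , trans (sym q) q′ , trans (sym e) (trans M≡N e′)
column-cofunctional {a} {b′ = b′} {M} {N} {i} {j} (swap _ _ p q e x) (stay _ _ e′ _) u l _ _ _ gap M≡N =
  contradiction gap (no-gap {b′ i j} {b′ (suc i) j} {prefix (a i) (suc j)} {prefix (a (suc i)) (suc j)}
    {x′ = prefix (b′ (suc i)) j} p q x u l (trans M≡N e′))
  where
  no-gap : ∀ {β β′ y y′ m x x′ n} → β ≡ 1ℤ → β′ ≡ 0ℤ → y′ - y ≡ m →
           x + β ≡ y + m → x′ + β′ ≡ y′ - m → m ≡ n → ¬ x′ + n ≤ x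
  no-gap {y = y} {y′} {x = x} {x′} refl refl refl u l refl p = 1+≰ (ℤ.≤-trans (ℤ.≤-reflexive
    (eq x x′ y y′ u l)) p)
    where
    eq : ∀ x x′ y y′ → x + 1ℤ ≡ y + (y′ - y) → x′ + 0ℤ ≡ y′ - (y′ - y) → x + 1ℤ ≡ x′ + (y′ - y)
    eq x x′ y y′ u l = begin
      x + 1ℤ                      ≡⟨ u ⟩
      y + (y′ - y)                ≡⟨ solve (y ∷ y′ ∷ []) ⟩
      (y′ - (y′ - y)) + (y′ - y)  ≡⟨ cong (_+ (y′ - y)) l ⟨
      x′ + 0ℤ + (y′ - y)          ≡⟨ cong (_+ (y′ - y)) (ℤ.+-identityʳ x′) ⟩
      x′ + (y′ - y)               ∎
      where open ≡-Reasoning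
column-cofunctional A@(stay _ _ _ _) B@(swap _ _ _ _ _ _) u l u′ l′ g g′ M≡N =
  let p , q , e = column-cofunctional B A u′ l′ u l g′ g (sym M≡N) in sym p , sym q , sym e

cases : ∀ {i r} {P : ℕ → Set} → (OtherRow i r → P r) → P i → P (suc i) → P r
cases {i} {r} other upper lower with r ℕ.≟ i | r ℕ.≟ suc i
... | yes refl | _        = upper
... | no _     | yes refl = lower
... | no r≢i   | no r≢i⁺  = other (r≢i , r≢i⁺)

pair-ext : ∀ {n} {s t : Pair n} →
           (∀ r j → entry (proj₁ s) r j ≡ entry (proj₁ t) r j) →
           (∀ r j → entry (proj₂ s) r j ≡ entry (proj₂ t) r j) → s ≡ t
pair-ext {s = s} {t} p q = cong₂ _,_ (entry-ext (proj₁ s) (proj₁ t) p) (entry-ext (proj₂ s) (proj₂ t) q)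

untangled-functional : ∀ {n k i} {s t u : Pair n} → Untangled k i s t → Untangled k i s u → t ≡ u
untangled-functional {k = k} {i} T U = pair-ext same-bits same-drops
  where
  module T = Untangled T
  module U = Untangled U

  M≡ : ∀ j → j ℕ.≤ k → T.M j ≡ U.M j
  M≡ zero    _   = trans T.M-zero (sym U.M-zero)
  M≡ (suc j) j<k =
    proj₂ (proj₂ (column-functional (T.columns j j<k) (U.columns j j<k) (M≡ j (ℕ.<⇒≤ j<k))))

  same-bits : ∀ r j → T.b′ r j ≡ U.b′ r j
  same-bits r j with j ℕ.<? k
  ... | no j≮k  = trans (T.same-b r j (inj₂ (ℕ.≮⇒≥ j≮k))) (sym (U.same-b r j (inj₂ (ℕ.≮⇒≥ j≮k))))
  ... | yes j<k = cases {P = λ r → T.b′ r j ≡ U.b′ r j}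
    (λ o → trans (T.same-b r j (inj₁ o)) (sym (U.same-b r j (inj₁ o)))) (proj₁ eqs) (proj₁ (proj₂ eqs))
    where eqs = column-functional (T.columns j j<k) (U.columns j j<k) (M≡ j (ℕ.<⇒≤ j<k))

  same-drops : ∀ r j → T.d′ r j ≡ U.d′ r j
  same-drops r j with j ℕ.≟ k
  ... | no j≢k   = trans (T.same-d r j (inj₂ j≢k)) (sym (U.same-d r j (inj₂ j≢k)))
  ... | yes refl = cases {P = λ r → T.d′ r j ≡ U.d′ r j}
    (λ o → trans (T.same-d r j (inj₁ o)) (sym (U.same-d r j (inj₁ o))))
    (trans T.d-upper (trans (cong (λ z → T.d i k - z) (M≡ k ℕ.≤-refl)) (sym U.d-upper)))
    (trans T.d-moved (trans (M≡ k ℕ.≤-refl) (sym U.d-moved)))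

untangled-cofunctional : ∀ {n k i} {s t u : Pair n} → Untangled k i s u → Untangled k i t u → s ≡ t
untangled-cofunctional {k = k} {i} S T = pair-ext same-bits same-drops
  where
  module S = Untangled S
  module T = Untangled T

  Determined : ℕ → Set
  Determined j = S.b i j ≡ T.b i j × S.b (suc i) j ≡ T.b (suc i) j × S.M j ≡ T.M j

  determined : ∀ j → j ℕ.< k → S.M (suc j) ≡ T.M (suc j) → Determined j
  determined j j<k = column-cofunctional (S.columns j j<k) (T.columns j j<k)
    (prefix-upper S.M-zero S.columns (suc j) j<k) (prefix-lower S.M-zero S.columns (suc j) j<k)
    (prefix-upper T.M-zero T.columns (suc j) j<k) (prefix-lower T.M-zero T.columns (suc j) j<k)
    (M≤gap S.M-zero S.columns j (ℕ.<⇒≤ j<k)) (M≤gap T.M-zero T.columns j (ℕ.<⇒≤ j<k))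

  M≡-last : S.M k ≡ T.M k
  M≡-last = trans (sym S.d-moved) T.d-moved

  -- Induction on the distance t to column k, where the vertical steps of row i+1 reveal M.
  M≡ : ∀ t j → j ℕ.+ t ≡ k → S.M j ≡ T.M j
  M≡ zero    j refl = subst (λ l → S.M l ≡ T.M l) (ℕ.+-identityʳ j) M≡-last
  M≡ (suc t) j refl =
    proj₂ (proj₂ (determined j (ℕ.m<m+n j ℕ.z<s) (M≡ t (suc j) (sym (ℕ.+-suc j t)))))

  same-bits : ∀ r j → S.b r j ≡ T.b r j
  same-bits r j with j ℕ.<? k
  ... | no j≮k  = trans (sym (S.same-b r j (inj₂ (ℕ.≮⇒≥ j≮k)))) (T.same-b r j (inj₂ (ℕ.≮⇒≥ j≮k)))
  ... | yes j<k = cases {P = λ r → S.b r j ≡ T.b r j}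
    (λ o → trans (sym (S.same-b r j (inj₁ o))) (T.same-b r j (inj₁ o))) (proj₁ eqs) (proj₁ (proj₂ eqs))
    where eqs = determined j j<k (M≡ (k ℕ.∸ suc j) (suc j) (ℕ.m+[n∸m]≡n j<k))

  same-drops : ∀ r j → S.d r j ≡ T.d r j
  same-drops r j with j ℕ.≟ k
  ... | no j≢k   = trans (sym (S.same-d r j (inj₂ j≢k))) (T.same-d r j (inj₂ j≢k))
  ... | yes refl = cases {P = λ r → S.d r j ≡ T.d r j}
    (λ o → trans (sym (S.same-d r j (inj₁ o))) (T.same-d r j (inj₁ o)))
    (sub-cancel (trans (sym S.d-upper) T.d-upper) M≡-last)
    (trans S.d-lower (sym T.d-lower))
    where
    sub-cancel : ∀ {x y m m′} → x - m ≡ y - m′ → m ≡ m′ → x ≡ y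
    sub-cancel {x} {y} {m} eq refl = +-cancelʳ (- m) x y eq

-- Bits, and updates of two entries in one column

Binary : ℤ → Set
Binary x = x ≡ 0ℤ ⊎ x ≡ 1ℤ

0≤bit : ∀ {x} → Binary x → 0ℤ ≤ x
0≤bit (inj₁ refl) = ℤ.≤-refl
0≤bit (inj₂ refl) = 0≤1

bit≤1 : ∀ {x} → Binary x → x ≤ 1ℤ
bit≤1 (inj₁ refl) = 0≤1
bit≤1 (inj₂ refl) = ℤ.≤-refl

module _ {n} (M : Matrix n) {r r′ c : Fin n} {x y : ℤ} where

  private M₂ = M ⟨ r , c ⟩≔ x ⟨ r′ , c ⟩≔ y

  entry-≔₂-fst : ∀ {a a′ j} → toℕ r ≡ a → toℕ r′ ≡ a′ → toℕ c ≡ j → a ≢ a′ → entry M₂ a j ≡ x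
  entry-≔₂-fst refl refl refl a≢a′ =
    trans (entry-≔-other (M ⟨ r , c ⟩≔ x) r′ c y (inj₁ a≢a′)) (entry-≔ M r c x)

  entry-≔₂-snd : ∀ {a′ j} → toℕ r′ ≡ a′ → toℕ c ≡ j → entry M₂ a′ j ≡ y
  entry-≔₂-snd refl refl = entry-≔ (M ⟨ r , c ⟩≔ x) r′ c y

  entry-≔₂-other : ∀ {a a′ j} → toℕ r ≡ a → toℕ r′ ≡ a′ → toℕ c ≡ j →
                   ∀ s l → (s ≢ a × s ≢ a′) ⊎ l ≢ j → entry M₂ s l ≡ entry M s l
  entry-≔₂-other refl refl refl s l (inj₁ (p , q)) =
    trans (entry-≔-other (M ⟨ r , c ⟩≔ x) r′ c y (inj₁ q)) (entry-≔-other M r c x (inj₁ p))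
  entry-≔₂-other refl refl refl s l (inj₂ p) =
    trans (entry-≔-other (M ⟨ r , c ⟩≔ x) r′ c y (inj₂ p)) (entry-≔-other M r c x (inj₂ p))

entry-at : ∀ {n} (M : Matrix n) {r c a j} → toℕ r ≡ a → toℕ c ≡ j → M ⟨ r , c ⟩ ≡ entry M a j
entry-at M refl refl = sym (entry-lookup M _ _)

column-cong : ∀ {a b a′ b′ e M i j} →
              b i j ≡ a i j → b (suc i) j ≡ a (suc i) j →
              b′ i j ≡ a′ i j → b′ (suc i) j ≡ a′ (suc i) j →
              Column a a′ e M i j → Column b b′ e M i j
column-cong p q p′ q′ (swap x y x′ y′ e m) =
  swap (trans p x) (trans q y) (trans p′ x′) (trans q′ y′) e m
column-cong p q p′ q′ (stay x y e m) =
  stay (trans p′ (trans x (sym p))) (trans q′ (trans y (sym q))) e m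

column-excess : ∀ {b b′ e e′ M i j} → e′ (suc j) ≡ e (suc j) → Column b b′ e M i j → Column b b′ e′ M i j
column-excess p (swap x y x′ y′ e m) = swap x y x′ y′ e (trans p m)
column-excess p (stay x y e m)       = stay x y e (subst (_≤ _) (sym p) m)

-- Two bits change `cur` by at most one. To pass a bound m that was not exceeded before, they must
-- be 0 and 1, and the new value is exactly m + 1.
new-record : ∀ {x y cur m} → Binary x → Binary y → cur ≤ m → m < cur + y - x →
             x ≡ 0ℤ × y ≡ 1ℤ × cur + y - x ≡ m + 1ℤ
new-record {cur = c} {m} (inj₁ refl) (inj₂ refl) c≤m m<c =
  refl , refl , ℤ.≤-antisym (≤-by₁ c≤m (solve (c ∷ m ∷ []))) (<⇒+1≤ m<c)
new-record {cur = c} {m} (inj₁ refl) (inj₁ refl) c≤m m<c =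
  contradiction (≤-by₁ {c = c + 0ℤ - 0ℤ} {d = m} c≤m (solve (c ∷ m ∷ []))) (ℤ.<⇒≱ m<c)
new-record {cur = c} {m} (inj₂ refl) (inj₂ refl) c≤m m<c =
  contradiction (≤-by₁ {c = c + 1ℤ - 1ℤ} {d = m} c≤m (solve (c ∷ m ∷ []))) (ℤ.<⇒≱ m<c)
new-record {cur = c} {m} (inj₂ refl) (inj₁ refl) c≤m m<c =
  contradiction (≤-by₂ {c = c + 0ℤ - 1ℤ} {d = m} c≤m 0≤1 (solve (c ∷ m ∷ []))) (ℤ.<⇒≱ m<c)

-- The left-to-right scan of `untangle`

Scan : ℕ → Set
Scan n = ℤ × ℤ × Matrix n

module Untangle {m} (i : Fin m) (k : Fin (suc m)) (B₀ D₀ : Matrix (suc m))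
                (binary : ∀ r j → Binary (entry B₀ r j)) where
  r r⁺ : Fin (suc m)
  r  = inject₁ i
  r⁺ = Fin.suc i

  -- The loop body that is local to Defs.untangle.
  body : Fin (suc m) → Scan (suc m) → Scan (suc m)
  body j (cur , d , B) =
    let cur′ = cur + B ⟨ r⁺ , j ⟩ - B ⟨ r , j ⟩ in
    if does (d <? cur′)
    then (cur′ , cur′ , (B ⟨ r , j ⟩≔ 1ℤ ⟨ r⁺ , j ⟩≔ 0ℤ))
    else (cur′ , d , B)

  scan : ℕ → Scan (suc m)
  scan j = for (below j) body (0ℤ , 0ℤ , B₀)

  private
    ι = toℕ i
    b = entry B₀

    r≡ : toℕ r ≡ ι
    r≡ = toℕ-inject₁ i

  max : ℕ → ℤ
  max j = proj₁ (proj₂ (scan j))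

  -- The function `max` is read off the run itself, so that the columns already treated can refer to
  -- earlier values of the running maximum. By `same` the scan always meets original bits.
  record Scanned (j : ℕ) (s : Scan (suc m)) : Set where
    B = entry (proj₂ (proj₂ s))
    field
      current : proj₁ s ≡ excess b ι j
      maximum : proj₁ (proj₂ s) ≡ max j
      columns : ∀ l → l ℕ.< j → Column b B (excess b ι) max ι l
      same    : ∀ a l → OtherRow ι a ⊎ j ℕ.≤ l → B a l ≡ b a l

  scan-zero : scan 0 ≡ (0ℤ , 0ℤ , B₀)
  scan-zero = cong (λ l → for l body (0ℤ , 0ℤ , B₀)) (below-zero (suc m))

  max-zero : max 0 ≡ 0ℤ
  max-zero = cong (λ s → proj₁ (proj₂ s)) scan-zero

  scan-step : ∀ (c : Fin (suc m)) → scan (suc (toℕ c)) ≡ body c (scan (toℕ c))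
  scan-step c = trans (cong (λ l → for l body (0ℤ , 0ℤ , B₀)) (below-∷ʳ c))
                      (for-∷ʳ (below (toℕ c)) c body (0ℤ , 0ℤ , B₀))

  private
    module Step (c : Fin (suc m)) (cur d : ℤ) (B : Matrix (suc m)) (S : Scanned (toℕ c) (cur , d , B)) where
      module S = Scanned S
      j = toℕ c
      cur′ = cur + B ⟨ r⁺ , c ⟩ - B ⟨ r , c ⟩

      x≡ : B ⟨ r , c ⟩ ≡ b ι j
      x≡ = trans (entry-at B r≡ refl) (S.same ι j (inj₂ ℕ.≤-refl))

      y≡ : B ⟨ r⁺ , c ⟩ ≡ b (suc ι) j
      y≡ = trans (entry-at B refl refl) (S.same (suc ι) j (inj₂ ℕ.≤-refl))

      cur′≡ : cur′ ≡ excess b ι (suc j)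
      cur′≡ = eq (prefix (b ι) j) (prefix (b (suc ι)) j) (b ι j) (b (suc ι) j) S.current x≡ y≡
        where
        eq : ∀ p q x y {c x′ y′} → c ≡ q - p → x′ ≡ x → y′ ≡ y → c + y′ - x′ ≡ (q + y) - (p + x)
        eq p q x y refl refl refl = solve (p ∷ q ∷ x ∷ y ∷ [])

      cur≤d : cur ≤ d
      cur≤d = subst₂ _≤_ (sym S.current) (sym S.maximum) (excess≤M {i = ι} max-zero S.columns j ℕ.≤-refl)

      raise : d < cur′ → max (suc j) ≡ cur′ →
              Scanned (suc j) (cur′ , cur′ , (B ⟨ r , c ⟩≔ 1ℤ ⟨ r⁺ , c ⟩≔ 0ℤ))
      raise d<cur′ next = record
        { current = cur′≡
        ; maximum = sym next
        ; columns = columns′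
        ; same    = λ a l off → trans (other a l (Data.Sum.map₂ ℕ.>⇒≢ off))
                                       (S.same a l (Data.Sum.map₂ ℕ.<⇒≤ off))
        }
        where
        other = entry-≔₂-other B {r} {r⁺} {c} {1ℤ} {0ℤ} r≡ refl refl
        bits = new-record (subst Binary (sym x≡) (binary ι j)) (subst Binary (sym y≡) (binary (suc ι) j))
                          cur≤d d<cur′
        columns′ : ∀ l → l ℕ.< suc j → Column b (entry (B ⟨ r , c ⟩≔ 1ℤ ⟨ r⁺ , c ⟩≔ 0ℤ)) (excess b ι) max ι l
        columns′ l l<1+j with l ℕ.≟ j
        ... | no l≢j = column-cong refl refl (other ι l (inj₂ l≢j)) (other (suc ι) l (inj₂ l≢j))
                         (S.columns l (ℕ.≤∧≢⇒< (ℕ.s≤s⁻¹ l<1+j) l≢j))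
        ... | yes refl = swap (trans (sym x≡) (proj₁ bits)) (trans (sym y≡) (proj₁ (proj₂ bits)))
          (entry-≔₂-fst B r≡ refl refl (ℕ.1+n≢n ∘ sym)) (entry-≔₂-snd B {r} refl refl)
          (trans next (trans (proj₂ (proj₂ bits)) (cong (_+ 1ℤ) S.maximum)))
          (trans (sym cur′≡) (sym next))

      keep : cur′ ≤ d → max (suc j) ≡ d → Scanned (suc j) (cur′ , d , B)
      keep cur′≤d next = record
        { current = cur′≡
        ; maximum = sym next
        ; columns = columns′
        ; same    = λ a l off → S.same a l (Data.Sum.map₂ ℕ.<⇒≤ off)
        }
        where
        columns′ : ∀ l → l ℕ.< suc j → Column b (entry B) (excess b ι) max ι l
        columns′ l l<1+j with l ℕ.≟ j
        ... | no l≢j   = S.columns l (ℕ.≤∧≢⇒< (ℕ.s≤s⁻¹ l<1+j) l≢j)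
        ... | yes refl = stay (S.same ι j (inj₂ ℕ.≤-refl)) (S.same (suc ι) j (inj₂ ℕ.≤-refl))
          (trans next S.maximum) (subst₂ _≤_ cur′≡ S.maximum cur′≤d)

  -- The state is kept abstract for the case distinction; the hypothesis on `max` ties it to the
  -- actual run.
  scanned-step : ∀ c s → Scanned (toℕ c) s →
                 max (suc (toℕ c)) ≡ proj₁ (proj₂ (body c s)) → Scanned (suc (toℕ c)) (body c s)
  scanned-step c (cur , d , B) S next with d <? (cur + B ⟨ r⁺ , c ⟩ - B ⟨ r , c ⟩)
  ... | yes d<cur′ = Step.raise c cur d B S d<cur′ next
  ... | no  d≮cur′ = Step.keep c cur d B S (ℤ.≮⇒≥ d≮cur′) next

  scanned : ∀ j → j ℕ.≤ suc m → Scanned j (scan j)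
  scanned zero j≤m = subst (Scanned 0) (sym scan-zero) record
    { current = refl
    ; maximum = sym max-zero
    ; columns = λ l ()
    ; same    = λ a l _ → refl
    }
  scanned (suc j) j<m = subst (λ j → Scanned (suc j) (scan (suc j))) (toℕ-fromℕ< j<m)
    (subst (Scanned (suc (toℕ c))) (sym (scan-step c))
      (scanned-step c (scan (toℕ c))
        (subst (λ j → Scanned j (scan j)) (sym (toℕ-fromℕ< j<m)) (scanned j (ℕ.<⇒≤ j<m)))
        (cong (λ s → proj₁ (proj₂ s)) (scan-step c))))
    where c = fromℕ< j<m

  -- `untangle` overwrites the entry of row i+1 in column k without reading it, so that entry has to
  -- be known beforehand.
  untangled : entry D₀ (suc ι) (toℕ k) ≡ 0ℤ → Untangled (toℕ k) ι (B₀ , D₀) (untangle i k (B₀ , D₀))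
  untangled D≡0 = record
    { M       = max
    ; M-zero  = max-zero
    ; columns = F.columns
    ; same-b  = F.same
    ; d-upper = trans (entry-≔₂-fst D₀ r≡ refl refl (ℕ.1+n≢n ∘ sym)) (cong (_- max (toℕ k)) (entry-at D₀ r≡ refl))
    ; d-lower = D≡0
    ; d-moved = entry-≔₂-snd D₀ {r} refl refl
    ; same-d  = entry-≔₂-other D₀ {r} {r⁺} {k} r≡ refl refl
    }
    where
    module F = Scanned (scanned (toℕ k) (ℕ.<⇒≤ (toℕ<n k)))

-- The right-to-left scan of `cliffify`

gap : Entries → ℕ → ℕ → ℤ
gap b i j = prefix (b i) j - prefix (b (suc i)) j

-- The minimum of d and of the t values from `g j` to `g (j + t - 1)`, accumulated from the right
-- with the very test of the loop, so that `min-step` matches one iteration.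
least : (ℕ → ℤ) → ℤ → ℕ → ℕ → ℤ
least g d zero    j = d
least g d (suc t) j =
  let l = least g d t (suc j) in if does (g j <? l) then g j else l

module Cliffify {m} (i : Fin m) (k : Fin (suc m)) (B₀ D₀ : Matrix (suc m)) (h₀ : Vec ℤ (suc m)) where
  r r⁺ : Fin (suc m)
  r  = inject₁ i
  r⁺ = Fin.suc i

  d₀ cur₀ : ℤ
  d₀   = D₀ ⟨ r⁺ , k ⟩
  cur₀ = Vec.lookup h₀ r⁺ - Vec.lookup h₀ r - 1ℤ

  -- The loop body that is local to Defs.cliffify.
  body : Fin (suc m) → Scan (suc m) → Scan (suc m)
  body j (cur , d , B) =
    let cur′ = cur + B ⟨ r⁺ , j ⟩ - B ⟨ r , j ⟩ in
    if does (cur′ <? d)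
    then (cur′ , cur′ , (B ⟨ r , j ⟩≔ 0ℤ ⟨ r⁺ , j ⟩≔ 1ℤ))
    else (cur′ , d , B)

  private
    ι = toℕ i
    κ = toℕ k
    b = entry B₀

    r≡ : toℕ r ≡ ι
    r≡ = toℕ-inject₁ i

  height-upper : at (proj₂ (cliffify i k ((B₀ , D₀) , h₀))) ι ≡ at h₀ ι + entry D₀ (suc ι) κ
  height-upper = subst (λ a → at h₁ a ≡ at h₀ a + entry D₀ (suc ι) κ) r≡
    (trans (at-≔ (h₀ [ r⁺ ]≔ (Vec.lookup h₀ r⁺ - d₀)) r _)
           (cong₂ _+_ (sym (at-lookup h₀ r)) (entry-at D₀ refl refl)))
    where h₁ = proj₂ (cliffify i k ((B₀ , D₀) , h₀))

  height-other : ∀ a → OtherRow ι a → at (proj₂ (cliffify i k ((B₀ , D₀) , h₀))) a ≡ at h₀ a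
  height-other a (a≢ι , a≢ι⁺) =
    trans (at-≔-other (h₀ [ r⁺ ]≔ (Vec.lookup h₀ r⁺ - d₀)) r _ (λ a≡ → a≢ι (trans a≡ r≡)))
          (at-≔-other h₀ r⁺ _ a≢ι⁺)

  module _ (binary   : ∀ r j → Binary (entry B₀ r j))
           (h-upper  : at h₀ ι ≡ + ι - prefix (b ι) κ)
           (h-lower  : at h₀ (suc ι) ≡ + suc ι - prefix (b (suc ι)) κ)
           (d-nonneg : 0ℤ ≤ entry D₀ (suc ι) κ)
           (d≤gap    : entry D₀ (suc ι) κ ≤ gap b ι κ)
           (0≤gap    : ∀ j → j ℕ.≤ κ → 0ℤ ≤ gap b ι j) where

    g : ℕ → ℤ
    g = gap b ι

    min : ℕ → ℤ
    min j = least g d₀ (κ ℕ.∸ j) j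

    min-last : min κ ≡ d₀
    min-last = cong (λ t → least g d₀ t κ) (ℕ.n∸n≡0 κ)

    min-step : ∀ j → j ℕ.< κ →
               min j ≡ (if does (g j <? min (suc j)) then g j else min (suc j))
    min-step j j<κ = cong (λ t → least g d₀ t j) (ℕ.+-∸-assoc 1 j<κ)

    d₀≡ : d₀ ≡ entry D₀ (suc ι) κ
    d₀≡ = entry-at D₀ refl refl

    -- The two paths start one apart, which the -1 in `cur₀` cancels; the difference of heights then
    -- is the gap of the diagonal counts.
    cur₀≡ : cur₀ ≡ g κ
    cur₀≡ = eq (+ ι) (prefix (b ι) κ) (prefix (b (suc ι)) κ)
      (trans (sym (at-lookup h₀ r)) (trans (cong (at h₀) r≡) h-upper))
      (trans (sym (at-lookup h₀ r⁺)) h-lower) (+suc ι)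
      where
      eq : ∀ p x y {p′ u v} → u ≡ p - x → v ≡ p′ - y → p′ ≡ p + 1ℤ → v - u - 1ℤ ≡ x - y
      eq p x y refl refl refl = solve (p ∷ x ∷ y ∷ [])

    min≤g : ∀ j → j ℕ.≤ κ → min j ≤ g j
    min≤g j j≤κ with ℕ.m≤n⇒m<n∨m≡n j≤κ
    ... | inj₂ refl = subst (_≤ g κ) (sym (trans min-last d₀≡)) d≤gap
    ... | inj₁ j<κ rewrite min-step j j<κ with g j <? min (suc j)
    ...   | yes _   = ℤ.≤-refl
    ...   | no g≮m  = ℤ.≮⇒≥ g≮m

    0≤min : ∀ t j → j ℕ.+ t ≡ κ → 0ℤ ≤ least g d₀ t j
    0≤min zero    j _  = subst (0ℤ ≤_) (sym d₀≡) d-nonneg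
    0≤min (suc t) j eq with g j <? least g d₀ t (suc j)
    ... | yes _ = 0≤gap j (subst (j ℕ.≤_) eq (ℕ.m≤m+n j (suc t)))
    ... | no _  = 0≤min t (suc j) (trans (sym (ℕ.+-suc j t)) eq)

    -- The gap before column 0 is 0, while d and all gaps are nonnegative. This is where the order
    -- of the two rows enters: it makes the recovered M start at 0.
    min-zero : min 0 ≡ 0ℤ
    min-zero = ℤ.≤-antisym (min≤g 0 z≤n) (0≤min κ 0 refl)

    -- The excess of the result, expressed by the gap of the input.
    e : ℕ → ℤ
    e j = min j + min j - g j

    -- Input and output change places: each `Column` leads from the matrix under construction to the
    -- input b. The excess of that matrix is not yet settled, because its columns before j may still
    -- change, so e stands in for it.
    record Scanned (j : ℕ) (s : Scan (suc m)) : Set where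
      B = entry (proj₂ (proj₂ s))
      field
        current : proj₁ s ≡ g j
        minimum : proj₁ (proj₂ s) ≡ min j
        columns : ∀ l → j ℕ.≤ l → l ℕ.< κ → Column B b e min ι l
        same    : ∀ a l → OtherRow ι a ⊎ l ℕ.< j ⊎ κ ℕ.≤ l → b a l ≡ B a l

    private
      module Step (c : Fin (suc m)) (c<κ : toℕ c ℕ.< κ) (cur d : ℤ) (B : Matrix (suc m))
                  (S : Scanned (suc (toℕ c)) (cur , d , B)) where
        module S = Scanned S
        j = toℕ c
        cur′ = cur + B ⟨ r⁺ , c ⟩ - B ⟨ r , c ⟩

        x≡ : B ⟨ r , c ⟩ ≡ b ι j
        x≡ = trans (entry-at B r≡ refl) (sym (S.same ι j (inj₂ (inj₁ ℕ.≤-refl))))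

        y≡ : B ⟨ r⁺ , c ⟩ ≡ b (suc ι) j
        y≡ = trans (entry-at B refl refl) (sym (S.same (suc ι) j (inj₂ (inj₁ ℕ.≤-refl))))

        cur′≡ : cur′ ≡ g j
        cur′≡ = eq (prefix (b ι) j) (prefix (b (suc ι)) j) (b ι j) (b (suc ι) j) S.current x≡ y≡
          where
          eq : ∀ p q x y {c x′ y′} → c ≡ (p + x) - (q + y) → x′ ≡ x → y′ ≡ y → c + y′ - x′ ≡ p - q
          eq p q x y refl refl refl = solve (p ∷ q ∷ x ∷ y ∷ [])

        d≤cur : d ≤ cur
        d≤cur = subst₂ _≤_ (sym S.minimum) (sym S.current) (min≤g (suc j) c<κ)

        before : ∀ {a l} → OtherRow ι a ⊎ l ℕ.< j ⊎ κ ℕ.≤ l → OtherRow ι a ⊎ l ℕ.< suc j ⊎ κ ℕ.≤ l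
        before = Data.Sum.map₂ (Data.Sum.map₁ ℕ.m<n⇒m<1+n)

        lower : cur′ < d → min j ≡ cur′ →
                Scanned j (cur′ , cur′ , (B ⟨ r , c ⟩≔ 0ℤ ⟨ r⁺ , c ⟩≔ 1ℤ))
        lower cur′<d next = record
          { current = cur′≡
          ; minimum = sym next
          ; columns = columns′
          ; same    = λ a l off → trans (S.same a l (before off)) (sym (other a l (Data.Sum.map₂ off≢ off)))
          }
          where
          off≢ : ∀ {l} → l ℕ.< j ⊎ κ ℕ.≤ l → l ≢ j
          off≢ (inj₁ l<j) = ℕ.<⇒≢ l<j
          off≢ (inj₂ κ≤l) = ℕ.>⇒≢ (ℕ.<-≤-trans c<κ κ≤l)
          other = entry-≔₂-other B {r} {r⁺} {c} {0ℤ} {1ℤ} r≡ refl refl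
          cur≡ : cur ≡ cur′ + B ⟨ r , c ⟩ - B ⟨ r⁺ , c ⟩
          cur≡ = eq cur (B ⟨ r , c ⟩) (B ⟨ r⁺ , c ⟩)
            where
            eq : ∀ c x y → c ≡ c + y - x + x - y
            eq c x y = solve (c ∷ x ∷ y ∷ [])
          -- Read from right to left, the column raises the gap from cur′ to cur.
          bits = new-record (subst Binary (sym y≡) (binary (suc ι) j)) (subst Binary (sym x≡) (binary ι j))
                   (ℤ.≤-refl {cur′}) (subst (cur′ <_) cur≡ (ℤ.<-≤-trans cur′<d d≤cur))
          -- From `cur′ < d`, `d ≤ cur` and `cur = cur′ + 1` it follows that the minimum meets the
          -- gap at the right end of the column. Both equations required by `swap` rest on this.
          d≡cur : d ≡ cur
          d≡cur = ℤ.≤-antisym d≤cur (subst (_≤ d) (sym (trans cur≡ (proj₂ (proj₂ bits)))) (<⇒+1≤ cur′<d))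
          columns′ : ∀ l → j ℕ.≤ l → l ℕ.< κ → Column (entry (B ⟨ r , c ⟩≔ 0ℤ ⟨ r⁺ , c ⟩≔ 1ℤ)) b e min ι l
          columns′ l j≤l l<κ with j ℕ.≟ l
          ... | no j≢l = column-cong (other ι l (inj₂ (j≢l ∘ sym))) (other (suc ι) l (inj₂ (j≢l ∘ sym))) refl refl
                           (S.columns l (ℕ.≤∧≢⇒< j≤l j≢l) l<κ)
          ... | yes refl = swap
            (entry-≔₂-fst B r≡ refl refl (ℕ.1+n≢n ∘ sym)) (entry-≔₂-snd B {r} refl refl)
            (trans (sym x≡) (proj₁ (proj₂ bits))) (trans (sym y≡) (proj₁ bits))
            (trans (sym S.minimum) (trans d≡cur (trans cur≡ (trans (proj₂ (proj₂ bits)) (cong (_+ 1ℤ) (sym next))))))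
            (eq (min (suc j)) (trans (sym S.current) (trans (sym d≡cur) S.minimum)))
            where
            eq : ∀ x {y} → y ≡ x → x + x - y ≡ x
            eq x refl = solve (x ∷ [])

        keep : d ≤ cur′ → min j ≡ d → Scanned j (cur′ , d , B)
        keep d≤cur′ next = record
          { current = cur′≡
          ; minimum = sym next
          ; columns = columns′
          ; same    = λ a l off → S.same a l (before off)
          }
          where
          columns′ : ∀ l → j ℕ.≤ l → l ℕ.< κ → Column (entry B) b e min ι l
          columns′ l j≤l l<κ with j ℕ.≟ l
          ... | no j≢l   = S.columns l (ℕ.≤∧≢⇒< j≤l j≢l) l<κ
          ... | yes refl = stay
            (S.same ι j (inj₂ (inj₁ ℕ.≤-refl))) (S.same (suc ι) j (inj₂ (inj₁ ℕ.≤-refl)))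
            (trans (sym S.minimum) (sym next))
            (≤-by₁ (min≤g (suc j) c<κ) (eq (min (suc j)) (g (suc j)) (trans next S.minimum)))
            where
            eq : ∀ x y {x′} → x′ ≡ x → x′ - (x + x - y) ≡ y - x
            eq x y refl = solve (x ∷ y ∷ [])

    scanned-step : ∀ c → toℕ c ℕ.< κ → ∀ s → Scanned (suc (toℕ c)) s → Scanned (toℕ c) (body c s)
    scanned-step c c<κ (cur , d , B) S
      with cur + B ⟨ r⁺ , c ⟩ - B ⟨ r , c ⟩ <? d | next
      where
      next : min (toℕ c) ≡ (let cur′ = cur + B ⟨ r⁺ , c ⟩ - B ⟨ r , c ⟩ in if does (cur′ <? d) then cur′ else d)
      next = trans (min-step (toℕ c) c<κ)
        (cong₂ (λ x y → if does (x <? y) then x else y)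
          (sym (Step.cur′≡ c c<κ cur d B S)) (sym (Scanned.minimum S)))
    ... | yes cur′<d | next = Step.lower c c<κ cur d B S cur′<d next
    ... | no  cur′≮d | next = Step.keep c c<κ cur d B S (ℤ.≮⇒≥ cur′≮d) next

    scanned : ∀ j → j ℕ.≤ κ → ∀ s → Scanned j s → Scanned 0 (for (reverse (below j)) body s)
    scanned zero    _   s S = subst (λ l → Scanned 0 (for (reverse l) body s)) (sym (below-zero (suc m))) S
    scanned (suc j) j<κ s S = subst (λ l → Scanned 0 (for l body s)) (sym rev)
      (scanned j (ℕ.<⇒≤ j<κ) (body c s)
        (subst (λ j → Scanned j (body c s)) c≡ (scanned-step c (subst (ℕ._< κ) (sym c≡) j<κ) s
          (subst (λ j → Scanned (suc j) s) (sym c≡) S))))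
      where
      j<m = ℕ.<-trans j<κ (toℕ<n k)
      c = fromℕ< j<m
      c≡ = toℕ-fromℕ< j<m
      rev : reverse (below (suc j)) ≡ c ∷ reverse (below j)
      rev = begin
        reverse (below (suc j))         ≡⟨ cong (λ j → reverse (below (suc j))) c≡ ⟨
        reverse (below (suc (toℕ c)))   ≡⟨ cong reverse (below-∷ʳ c) ⟩
        reverse (below (toℕ c) ∷ʳ c)    ≡⟨ reverse-∷ʳ (below (toℕ c)) c ⟩
        c ∷ reverse (below (toℕ c))     ≡⟨ cong (λ j → c ∷ reverse (below j)) c≡ ⟩
        c ∷ reverse (below j)           ∎
        where open ≡-Reasoning

    -- Once all columns are treated, the prefix formulas express the excess of the result as 2 M
    -- minus the gap of the input. This is e, so the columns acquire the form that `Untangled`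
    -- demands.
    untangled : Untangled κ ι (proj₁ (cliffify i k ((B₀ , D₀) , h₀))) (B₀ , D₀)
    untangled = record
      { M       = min
      ; M-zero  = min-zero
      ; columns = λ j j<κ → column-excess (excess≡ (suc j) j<κ) (columns j j<κ)
      ; same-b  = λ a l off → F.same a l (Data.Sum.map₂ inj₂ off)
      ; d-upper = upper
      ; d-lower = entry-≔₂-fst D₀ refl r≡ refl ℕ.1+n≢n
      ; d-moved = sym (trans min-last d₀≡)
      ; same-d  = λ a l off → sym (entry-≔₂-other D₀ {r⁺} {r} {k} refl r≡ refl a l (Data.Sum.map₁ Data.Product.swap off))
      }
      where
      start : Scanned κ (cur₀ , d₀ , B₀)
      start = record
        { current = cur₀≡
        ; minimum = sym min-last
        ; columns = λ l κ≤l l<κ → contradiction κ≤l (ℕ.<⇒≱ l<κ)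
        ; same    = λ a l _ → refl
        }
      module F = Scanned (scanned κ ℕ.≤-refl (cur₀ , d₀ , B₀) start)
      columns : ∀ j → j ℕ.< κ → Column F.B b e min ι j
      columns j = F.columns j z≤n
      upper : entry D₀ ι κ ≡ entry (proj₂ (proj₁ (cliffify i k ((B₀ , D₀) , h₀)))) ι κ - min κ
      upper = eq (entry D₀ ι κ) d₀
        (trans (entry-≔₂-snd D₀ {r⁺} {r} r≡ refl) (cong (_+ d₀) (entry-at D₀ r≡ refl))) min-last
        where
        eq : ∀ x d {x′ d′} → x′ ≡ x + d → d′ ≡ d → x ≡ x′ - d′
        eq x d refl refl = solve (x ∷ d ∷ [])
      excess≡ : ∀ j → j ℕ.≤ κ → excess F.B ι j ≡ e j
      excess≡ j j≤κ = eq (prefix (F.B ι) j) (prefix (F.B (suc ι)) j) (min j)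
        (prefix-upper min-zero columns j j≤κ) (prefix-lower min-zero columns j j≤κ)
        where
        eq : ∀ x y m {x′ y′} → x′ ≡ x + m → y′ ≡ y - m → y - x ≡ m + m - (x′ - y′)
        eq x y m refl refl = solve (x ∷ y ∷ m ∷ [])

-- The loop invariant and its transport in both directions

module _ {n : ℕ} (s : Pair n) where
  bits drops : Entries
  bits  = entry (proj₁ s)
  drops = entry (proj₂ s)

  -- Diagonal and vertical steps lower the first coordinate by one, so a path P_r encoded by s
  -- enters column j at first coordinate r - fall r j.
  fall : ℕ → ℕ → ℤ
  fall r = prefix (λ l → bits r l + drops r l)

-- The state of either loop at k when rows i and i+1 are next to be untangled,
-- or have just been cliffified. N bounds how far row i can still be moved.
record Invariant (n k i : ℕ) (s : Pair n) : Set where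
  private
    X : ℕ → ℕ → ℤ
    X r = prefix (bits s r)
    d = drops s
  field
    N          : ℕ → ℤ
    N-zero     : N 0 ≡ 0ℤ
    N-mono     : ∀ j → j ℕ.< k → N j ≤ N (suc j)
    N-last     : N k ≤ d i k
    done       : ∀ r → k ℕ.≤ r → r ℕ.< i → ∀ j → j ℕ.≤ k → X (suc r) j ≤ X r j
    done-last  : ∀ r → k ℕ.≤ r → r ℕ.< i → X (suc r) k + d (suc r) k ≤ X r k
    behind     : ∀ r → k ℕ.≤ r → suc r ≡ i → ∀ j → j ℕ.≤ k → X i j + N j ≤ X r j
    ahead      : suc i ℕ.< n → ∀ j → j ℕ.≤ k → X (suc i) j ≤ X i j + N j
    later      : ∀ r → i ℕ.< r → suc r ℕ.< n → ∀ j → j ℕ.≤ k → X (suc r) j ≤ X r j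
    later-flat : ∀ r → i ℕ.< r → r ℕ.< n → d r k ≡ 0ℤ
    d-nonneg   : ∀ r → 0ℤ ≤ d r k

module _ {n k i : ℕ} {s s′ : Pair n} (U : Untangled k i s s′) where
  private
    module U = Untangled U
    open U using (M; M-zero; columns)

    X X′ : ℕ → ℕ → ℤ
    X  r = prefix (bits s r)
    X′ r = prefix (bits s′ r)
    d  = drops s
    d′ = drops s′

    X-other : ∀ {r} → OtherRow i r → ∀ j → X′ r j ≡ X r j
    X-other {r} o j = prefix-cong j (λ l _ → U.same-b r l (inj₁ o))

    d-other : ∀ {r} → OtherRow i r → d′ r k ≡ d r k
    d-other {r} o = U.same-d r k (inj₁ o)

    X-upper : ∀ j → j ℕ.≤ k → X′ i j ≡ X i j + M j
    X-upper = prefix-upper M-zero columns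

    X-lower : ∀ j → j ℕ.≤ k → X′ (suc i) j ≡ X (suc i) j - M j
    X-lower = prefix-lower M-zero columns

    M-gap : ∀ j → j ℕ.≤ k → X′ (suc i) j + M j ≤ X′ i j
    M-gap = M≤gap M-zero columns

    0≤M : ∀ j → j ℕ.≤ k → 0ℤ ≤ M j
    0≤M zero    _   = ℤ.≤-reflexive (sym M-zero)
    0≤M (suc j) j<k = ℤ.≤-trans (0≤M j (ℕ.<⇒≤ j<k)) (M-mono M-zero columns j j<k)

    before : ∀ {r} → r ℕ.< i → OtherRow i r
    before r<i = ℕ.<⇒≢ r<i , ℕ.<⇒≢ (ℕ.m<n⇒m<1+n r<i)

    after : ∀ {r} → suc i ℕ.< r → OtherRow i r
    after i⁺<r = ℕ.>⇒≢ (ℕ.<-trans (ℕ.n<1+n i) i⁺<r) , ℕ.>⇒≢ i⁺<r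

  -- The new N is the M of this step, and the old N bounds it. Hence the raised row i is still
  -- bounded by row i-1 through `behind`, and `N-last` leaves it enough vertical steps. The new
  -- `ahead` is the old `later`, since row i+1 was lowered by just M.
  invariant-step : k ℕ.≤ i → suc i ℕ.< n → Invariant n k i s → Invariant n k (suc i) s′
  invariant-step k≤i i⁺<n I = record
    { N          = M
    ; N-zero     = M-zero
    ; N-mono     = M-mono M-zero columns
    ; N-last     = ℤ.≤-reflexive (sym U.d-moved)
    ; done       = done
    ; done-last  = done-last
    ; behind     = λ { r _ refl → M-gap }
    ; ahead      = λ i⁺⁺<n j j≤k → subst₂ _≤_ (sym (X-other (after ℕ.≤-refl) j))
                     (trans (eq (X (suc i) j) (M j)) (cong (_+ M j) (sym (X-lower j j≤k))))
                     (I.later (suc i) ℕ.≤-refl i⁺⁺<n j j≤k)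
    ; later      = λ r i⁺<r r⁺<n j j≤k →
                     subst₂ _≤_ (sym (X-other (after (ℕ.m<n⇒m<1+n i⁺<r)) j)) (sym (X-other (after i⁺<r) j))
                       (I.later r (ℕ.<-trans (ℕ.n<1+n i) i⁺<r) r⁺<n j j≤k)
    ; later-flat = λ r i⁺<r r<n → trans (d-other (after i⁺<r)) (I.later-flat r (ℕ.<-trans (ℕ.n<1+n i) i⁺<r) r<n)
    ; d-nonneg   = d-nonneg
    }
    where
    module I = Invariant I
    open I using (N)

    eq : ∀ x m → x ≡ x - m + m
    eq x m = solve (x ∷ m ∷ [])

    -- N is nondecreasing, starts at 0 and bounds the excess by `ahead`; the running maximum is the
    -- least such function.
    M≤N : ∀ j → j ℕ.≤ k → M j ≤ N j
    M≤N zero    _   = ℤ.≤-reflexive (trans M-zero (sym I.N-zero))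
    M≤N (suc j) j<k with columns j j<k
    ... | swap _ _ _ _ _ e = subst (_≤ N (suc j)) e
      (≤-by₁ (I.ahead i⁺<n (suc j) j<k) (eq′ (X i (suc j)) (X (suc i) (suc j)) (N (suc j))))
      where
      eq′ : ∀ x y n → n - (y - x) ≡ x + n - y
      eq′ x y n = solve (x ∷ y ∷ n ∷ [])
    ... | stay _ _ e _ = subst (_≤ N (suc j)) (sym e) (ℤ.≤-trans (M≤N j (ℕ.<⇒≤ j<k)) (I.N-mono j j<k))

    done : ∀ r → k ℕ.≤ r → r ℕ.< suc i → ∀ j → j ℕ.≤ k → X′ (suc r) j ≤ X′ r j
    done r k≤r r<i⁺ j j≤k with ℕ.m≤n⇒m<n∨m≡n (ℕ.s≤s⁻¹ r<i⁺)
    ... | inj₂ refl = ≤-by₂ (M-gap j j≤k) (0≤M j j≤k) (eq′ (X′ i j) (X′ (suc i) j) (M j))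
      where
      eq′ : ∀ x y m → x - y ≡ x - (y + m) + (m - 0ℤ)
      eq′ x y m = solve (x ∷ y ∷ m ∷ [])
    ... | inj₁ r<i with ℕ.m≤n⇒m<n∨m≡n r<i
    ...   | inj₁ r⁺<i = subst₂ _≤_ (sym (X-other (before r⁺<i) j)) (sym (X-other (before r<i) j)) (I.done r k≤r r<i j j≤k)
    ...   | inj₂ refl = subst₂ _≤_ (sym (X-upper j j≤k)) (sym (X-other (before r<i) j))
      (ℤ.≤-trans (ℤ.+-monoʳ-≤ (X i j) (M≤N j j≤k)) (I.behind r k≤r refl j j≤k))

    done-last : ∀ r → k ℕ.≤ r → r ℕ.< suc i → X′ (suc r) k + d′ (suc r) k ≤ X′ r k
    done-last r k≤r r<i⁺ with ℕ.m≤n⇒m<n∨m≡n (ℕ.s≤s⁻¹ r<i⁺)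
    ... | inj₂ refl = subst (λ m → X′ (suc i) k + m ≤ X′ i k) (sym U.d-moved) (M-gap k ℕ.≤-refl)
    ... | inj₁ r<i with ℕ.m≤n⇒m<n∨m≡n r<i
    ...   | inj₁ r⁺<i = subst₂ _≤_ (sym (cong₂ _+_ (X-other (before r⁺<i) k) (d-other (before r⁺<i))))
                                  (sym (X-other (before r<i) k)) (I.done-last r k≤r r<i)
    -- Row i gains M k diagonal steps before column k and loses as many vertical steps in it, so its
    -- sum in `done-last` is unchanged.
    ...   | inj₂ refl = subst₂ _≤_ (eq′ (X i k) (d i k) (M k) (X-upper k ℕ.≤-refl) U.d-upper)
                                  (sym (X-other (before r<i) k)) (I.done-last r k≤r r<i)
      where
      eq′ : ∀ x y m {x′ y′} → x′ ≡ x + m → y′ ≡ y - m → x + y ≡ x′ + y′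
      eq′ x y m refl refl = solve (x ∷ y ∷ m ∷ [])

    d-nonneg : ∀ r → 0ℤ ≤ d′ r k
    d-nonneg r = cases {P = λ r → 0ℤ ≤ d′ r k}
      (λ o → subst (0ℤ ≤_) (sym (d-other o)) (I.d-nonneg r))
      (subst (0ℤ ≤_) (sym U.d-upper) (ℤ.i≤j⇒0≤j-i (ℤ.≤-trans (M≤N k ℕ.≤-refl) I.N-last)))
      (subst (0ℤ ≤_) (sym U.d-moved) (0≤M k ℕ.≤-refl))

  -- Now the new N is the M just undone, and it bounds the old N; this gives `later` for rows i+1
  -- and i+2. `ahead` says that M bounds the excess, and `behind` that the raised row i was bounded
  -- by row i-1.
  invariant-unstep : k ℕ.≤ i → Invariant n k (suc i) s′ → Invariant n k i s
  invariant-unstep k≤i I = record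
    { N          = M
    ; N-zero     = M-zero
    ; N-mono     = M-mono M-zero columns
    ; N-last     = ≤-by₁ (I.d-nonneg i) (eq₁ (d i k) (M k) U.d-upper)
    ; done       = done
    ; done-last  = done-last
    ; behind     = λ { r k≤r refl j j≤k → subst₂ _≤_ (X-upper j j≤k) (X-other (before ℕ.≤-refl) j)
                         (I.done r k≤r (ℕ.m<n⇒m<1+n ℕ.≤-refl) j j≤k) }
    ; ahead      = λ _ j j≤k → ≤-by₁ (excess≤M M-zero columns j j≤k) (eq₂ (X i j) (X (suc i) j) (M j))
    ; later      = later
    ; later-flat = later-flat
    ; d-nonneg   = d-nonneg
    }
    where
    module I = Invariant I
    open I using (N)

    eq₁ : ∀ x m {y} → y ≡ x - m → x - m ≡ y - 0ℤ
    eq₁ x m refl = solve (x ∷ m ∷ [])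

    eq₂ : ∀ x y m → x + m - y ≡ m - (y - x)
    eq₂ x y m = solve (x ∷ y ∷ m ∷ [])

    -- The comparison starts at column k, where `N-last` bounds N by the vertical steps of row i+1,
    -- whose number is M k, and proceeds backwards.
    N≤M′ : ∀ t j → j ℕ.+ t ≡ k → N j ≤ M j
    N≤M′ zero    j refl = subst (λ j → N j ≤ M j) (ℕ.+-identityʳ j) (subst (N k ≤_) U.d-moved I.N-last)
    N≤M′ (suc t) j refl with columns j (ℕ.m<m+n j ℕ.z<s)
    ... | stay _ _ e _ = subst (N j ≤_) e
      (ℤ.≤-trans (I.N-mono j (ℕ.m<m+n j ℕ.z<s)) (N≤M′ t (suc j) (sym (ℕ.+-suc j t))))
    -- Before a new record of the excess the gap of the result equals M.
    ... | swap p q _ _ e e′ = ≤-by₁ (I.behind i k≤i refl j j≤k)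
      (eq′ (X i j) (X (suc i) j) (M j) p q e e′ (X-upper j j≤k) (X-lower j j≤k))
      where
      j≤k = ℕ.m≤m+n j (suc t)
      eq′ : ∀ x y m {n β β⁺ m⁺ x′ y′} → β ≡ 0ℤ → β⁺ ≡ 1ℤ → m⁺ ≡ m + 1ℤ → (y + β⁺) - (x + β) ≡ m⁺ →
            x′ ≡ x + m → y′ ≡ y - m → m - n ≡ x′ - (y′ + n)
      eq′ x y m {n} refl refl refl e refl refl = begin
        m - n                                 ≡⟨ solve (m ∷ n ∷ []) ⟩
        m + m - (m + 1ℤ) + 1ℤ - n             ≡⟨ cong (λ z → m + m - z + 1ℤ - n) e ⟨
        m + m - (y + 1ℤ - (x + 0ℤ)) + 1ℤ - n  ≡⟨ solve (x ∷ y ∷ m ∷ n ∷ []) ⟩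
        x + m - (y - m + n)                   ∎
        where open ≡-Reasoning

    N≤M : ∀ j → j ℕ.≤ k → N j ≤ M j
    N≤M j j≤k = N≤M′ (k ℕ.∸ j) j (ℕ.m+[n∸m]≡n j≤k)

    done : ∀ r → k ℕ.≤ r → r ℕ.< i → ∀ j → j ℕ.≤ k → X (suc r) j ≤ X r j
    done r k≤r r<i j j≤k with ℕ.m≤n⇒m<n∨m≡n r<i | I.done r k≤r (ℕ.m<n⇒m<1+n r<i) j j≤k
    ... | inj₁ r⁺<i | le = subst₂ _≤_ (X-other (before r⁺<i) j) (X-other (before r<i) j) le
    ... | inj₂ refl | le = ≤-by₂ le (0≤M j j≤k) (eq′ (X i j) (M j) (X-other (before r<i) j) (X-upper j j≤k))
      where
      eq′ : ∀ x m {y y′ x′} → y′ ≡ y → x′ ≡ x + m → y - x ≡ y′ - x′ + (m - 0ℤ)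
      eq′ x m {y} refl refl = solve (x ∷ m ∷ y ∷ [])

    done-last : ∀ r → k ℕ.≤ r → r ℕ.< i → X (suc r) k + d (suc r) k ≤ X r k
    done-last r k≤r r<i with ℕ.m≤n⇒m<n∨m≡n r<i | I.done-last r k≤r (ℕ.m<n⇒m<1+n r<i)
    ... | inj₁ r⁺<i | le =
      subst₂ _≤_ (cong₂ _+_ (X-other (before r⁺<i) k) (d-other (before r⁺<i))) (X-other (before r<i) k) le
    ... | inj₂ refl | le =
      subst₂ _≤_ (eq′ (X i k) (d i k) (M k) (X-upper k ℕ.≤-refl) U.d-upper) (X-other (before r<i) k) le
      where
      eq′ : ∀ x y m {x′ y′} → x′ ≡ x + m → y′ ≡ y - m → x′ + y′ ≡ x + y
      eq′ x y m refl refl = solve (x ∷ y ∷ m ∷ [])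

    later : ∀ r → i ℕ.< r → suc r ℕ.< n → ∀ j → j ℕ.≤ k → X (suc r) j ≤ X r j
    later r i<r r⁺<n j j≤k with ℕ.m≤n⇒m<n∨m≡n i<r
    ... | inj₁ i⁺<r = subst₂ _≤_ (X-other (after (ℕ.m<n⇒m<1+n i⁺<r)) j) (X-other (after i⁺<r) j)
                        (I.later r i⁺<r r⁺<n j j≤k)
    ... | inj₂ refl = ≤-by₂ (I.ahead r⁺<n j j≤k) (N≤M j j≤k)
      (eq′ (X (suc i) j) (M j) (N j) (X-other (after ℕ.≤-refl) j) (X-lower j j≤k))
      where
      eq′ : ∀ x m n {y y′ x′} → y′ ≡ y → x′ ≡ x - m → x - y ≡ x′ + n - y′ + (m - n)
      eq′ x m n {y} refl refl = solve (x ∷ m ∷ n ∷ y ∷ [])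

    later-flat : ∀ r → i ℕ.< r → r ℕ.< n → d r k ≡ 0ℤ
    later-flat r i<r r<n with ℕ.m≤n⇒m<n∨m≡n i<r
    ... | inj₁ i⁺<r = trans (sym (d-other (after i⁺<r))) (I.later-flat r i⁺<r r<n)
    ... | inj₂ refl = U.d-lower

    d-nonneg : ∀ r → 0ℤ ≤ d r k
    d-nonneg r = cases {P = λ r → 0ℤ ≤ d r k}
      (λ o → subst (0ℤ ≤_) (d-other o) (I.d-nonneg r))
      (≤-by₂ (I.d-nonneg i) (0≤M k ℕ.≤-refl) (eq′ (d i k) (M k) U.d-upper))
      (ℤ.≤-reflexive (sym U.d-lower))
      where
      eq′ : ∀ x m {x′} → x′ ≡ x - m → x - 0ℤ ≡ x′ - 0ℤ + (m - 0ℤ)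
      eq′ x m refl = solve (x ∷ m ∷ [])

-- What untangling never changes

record Frame {n} (k : ℕ) (s s′ : Pair n) : Set where
  field
    same-b   : ∀ r j → r ℕ.< k ⊎ k ℕ.≤ j → bits s′ r j ≡ bits s r j
    same-d   : ∀ r j → r ℕ.< k ⊎ j ≢ k → drops s′ r j ≡ drops s r j
    same-sum : ∀ r → fall s′ r (suc k) ≡ fall s r (suc k)
    binary   : ∀ r j → Binary (bits s r j) → Binary (bits s′ r j)
    binary⁻¹ : ∀ r j → Binary (bits s′ r j) → Binary (bits s r j)

frame-refl : ∀ {n k} {s : Pair n} → Frame k s s
frame-refl = record
  { same-b = λ _ _ _ → refl ; same-d = λ _ _ _ → refl ; same-sum = λ _ → refl
  ; binary = λ _ _ p → p ; binary⁻¹ = λ _ _ p → p }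

frame-sym : ∀ {n k} {s t : Pair n} → Frame k s t → Frame k t s
frame-sym F = record
  { same-b = λ r j o → sym (F.same-b r j o) ; same-d = λ r j o → sym (F.same-d r j o)
  ; same-sum = λ r → sym (F.same-sum r)
  ; binary = F.binary⁻¹ ; binary⁻¹ = F.binary }
  where module F = Frame F

frame-trans : ∀ {n k} {s t u : Pair n} → Frame k s t → Frame k t u → Frame k s u
frame-trans F G = record
  { same-b = λ r j o → trans (G.same-b r j o) (F.same-b r j o)
  ; same-d = λ r j o → trans (G.same-d r j o) (F.same-d r j o)
  ; same-sum = λ r → trans (G.same-sum r) (F.same-sum r)
  ; binary = λ r j → G.binary r j ∘ F.binary r j
  ; binary⁻¹ = λ r j → F.binary⁻¹ r j ∘ G.binary⁻¹ r j }
  where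
  module F = Frame F
  module G = Frame G

prefix-+ : ∀ f g j → prefix (λ l → f l + g l) j ≡ prefix f j + prefix g j
prefix-+ f g zero    = refl
prefix-+ f g (suc j) = eq (prefix f j) (prefix g j) (f j) (g j) (prefix-+ f g j)
  where
  eq : ∀ a b x y {c} → c ≡ a + b → c + (x + y) ≡ (a + x) + (b + y)
  eq a b x y refl = solve (a ∷ b ∷ x ∷ y ∷ [])

-- For the sums: the M k diagonal steps that row i gains and row i+1 loses before column k are
-- balanced in each row by as many vertical steps in column k.
untangled-frame : ∀ {n k i} {s s′ : Pair n} → k ℕ.≤ i → Untangled k i s s′ → Frame k s s′
untangled-frame {n} {k} {i} {s} {s′} k≤i U = record
  { same-b   = λ r j → U.same-b r j ∘ Data.Sum.map₁ above
  ; same-d   = λ r j → U.same-d r j ∘ Data.Sum.map₁ above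
  ; same-sum = λ r → cases {P = λ r → fall s′ r (suc k) ≡ fall s r (suc k)} (sum-other r) sum-upper sum-lower
  ; binary   = λ r j → bit b b′ r j (λ { (swap _ _ p _ _ _) _ → inj₂ p ; (stay p _ _ _) q → subst Binary (sym p) q })
                              (λ { (swap _ _ _ p _ _) _ → inj₁ p ; (stay _ p _ _) q → subst Binary (sym p) q })
                              (λ e → subst Binary (sym e))
  ; binary⁻¹ = λ r j → bit b′ b r j (λ { (swap p _ _ _ _ _) _ → inj₁ p ; (stay p _ _ _) q → subst Binary p q })
                              (λ { (swap _ p _ _ _ _) _ → inj₂ p ; (stay _ p _ _) q → subst Binary p q })
                              (λ e → subst Binary e)
  }
  where
  module U = Untangled U
  open U using (M; b; b′; d; d′)

  above : ∀ {r} → r ℕ.< k → OtherRow i r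
  above r<k = ℕ.<⇒≢ (ℕ.<-≤-trans r<k k≤i) , ℕ.<⇒≢ (ℕ.<-≤-trans r<k (ℕ.m≤n⇒m≤1+n k≤i))

  bit : ∀ (f g : Entries) r j →
        (Column b b′ (excess b i) M i j → Binary (f i j) → Binary (g i j)) →
        (Column b b′ (excess b i) M i j → Binary (f (suc i) j) → Binary (g (suc i) j)) →
        (b′ r j ≡ b r j → Binary (f r j) → Binary (g r j)) → Binary (f r j) → Binary (g r j)
  bit f g r j upper lower same with j ℕ.<? k
  ... | no j≮k  = same (U.same-b r j (inj₂ (ℕ.≮⇒≥ j≮k)))
  ... | yes j<k = cases {P = λ r → Binary (f r j) → Binary (g r j)} (λ o → same (U.same-b r j (inj₁ o)))
                    (upper (U.columns j j<k)) (lower (U.columns j j<k))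

  flat : ∀ r → prefix (d′ r) k ≡ prefix (d r) k
  flat r = prefix-cong k (λ l l<k → U.same-d r l (inj₂ (ℕ.<⇒≢ l<k)))

  sum-other : ∀ r → OtherRow i r → fall s′ r (suc k) ≡ fall s r (suc k)
  sum-other r o = prefix-cong (suc k) (λ l _ → cong₂ _+_ (U.same-b r l (inj₁ o)) (U.same-d r l (inj₁ o)))

  sum-upper : fall s′ i (suc k) ≡ fall s i (suc k)
  sum-upper = eq (prefix (b i) k) (prefix (d i) k) (b i k) (d i k) (M k)
    (prefix-+ (b i) (d i) k) (trans (prefix-+ (b′ i) (d′ i) k)
      (cong₂ _+_ (prefix-upper U.M-zero U.columns k ℕ.≤-refl) (flat i)))
    (U.same-b i k (inj₂ ℕ.≤-refl)) U.d-upper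
    where
    eq : ∀ x y β δ m {z z′ β′ δ′} → z ≡ x + y → z′ ≡ x + m + y → β′ ≡ β → δ′ ≡ δ - m →
         z′ + (β′ + δ′) ≡ z + (β + δ)
    eq x y β δ m refl refl refl refl = solve (x ∷ y ∷ β ∷ δ ∷ m ∷ [])

  sum-lower : fall s′ (suc i) (suc k) ≡ fall s (suc i) (suc k)
  sum-lower = eq (prefix (b (suc i)) k) (prefix (d (suc i)) k) (b (suc i) k) (M k)
    (prefix-+ (b (suc i)) (d (suc i)) k) (trans (prefix-+ (b′ (suc i)) (d′ (suc i)) k)
      (cong₂ _+_ (prefix-lower U.M-zero U.columns k ℕ.≤-refl) (flat (suc i))))
    (U.same-b (suc i) k (inj₂ ℕ.≤-refl)) U.d-lower U.d-moved
    where
    eq : ∀ x y β m {z z′ β′ δ δ′} → z ≡ x + y → z′ ≡ x - m + y → β′ ≡ β → δ ≡ 0ℤ → δ′ ≡ m →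
         z′ + (β′ + δ′) ≡ z + (β + δ)
    eq x y β m refl refl refl refl refl = solve (x ∷ y ∷ β ∷ m ∷ [])

-- Families in terms of their matrices

-- The last field says that P_{r+1} leaves column j above the point where P_r enters it.
record Ordered (n k : ℕ) (s : Pair n) : Set where
  field
    b-lower    : ∀ r j → r ℕ.≤ j → bits s r j ≡ 0ℤ
    binary     : ∀ r j → Binary (bits s r j)
    d-lower    : ∀ r j → r ℕ.< j → drops s r j ≡ 0ℤ
    d-nonneg   : ∀ r j → 0ℤ ≤ drops s r j
    total      : ∀ r → r ℕ.< n → fall s r (suc r) ≡ + r
    noVertical : ∀ r j → j ℕ.< k → j ℕ.< r → drops s r j ≡ 0ℤ
    order      : ∀ r j → k ℕ.≤ r → suc r ℕ.< n → j ℕ.≤ r →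
                 fall s (suc r) j + drops s (suc r) j ≤ fall s r j

-- The part of Ordered that is insensitive to untangling at k.
record Base (n k : ℕ) (s : Pair n) : Set where
  field
    b-lower    : ∀ r j → r ℕ.≤ j → bits s r j ≡ 0ℤ
    binary     : ∀ r j → Binary (bits s r j)
    d-lower    : ∀ r j → r ℕ.< j → drops s r j ≡ 0ℤ
    d-nonneg   : ∀ r j → j ≢ k → 0ℤ ≤ drops s r j
    total      : ∀ r → r ℕ.< n → fall s r (suc r) ≡ + r
    noVertical : ∀ r j → j ℕ.< k → j ℕ.< r → drops s r j ≡ 0ℤ
    order      : ∀ r j → k ℕ.< j → suc r ℕ.< n → j ℕ.≤ r →
                 fall s (suc r) j + drops s (suc r) j ≤ fall s r j

ordered⇒base : ∀ {n k s} → Ordered n k s → Base n k s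
ordered⇒base O = record
  { b-lower = b-lower ; binary = binary ; d-lower = d-lower ; d-nonneg = λ r j _ → d-nonneg r j
  ; total = total ; noVertical = noVertical
  ; order = λ r j k<j r⁺<n j≤r → order r j (ℕ.≤-trans (ℕ.<⇒≤ k<j) j≤r) r⁺<n j≤r }
  where open Ordered O

ordered⁺⇒base : ∀ {n k s} → Ordered n (suc k) s → Base n k s
ordered⁺⇒base O = record
  { b-lower = b-lower ; binary = binary ; d-lower = d-lower ; d-nonneg = λ r j _ → d-nonneg r j
  ; total = total ; noVertical = λ r j j<k → noVertical r j (ℕ.m<n⇒m<1+n j<k)
  ; order = λ r j k<j r⁺<n j≤r → order r j (ℕ.≤-trans k<j j≤r) r⁺<n j≤r }
  where open Ordered O

-- Each condition concerns an unchanged entry, the range of a bit, or a sum that runs over an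
-- untouched row or past column k; all of these are covered by `Frame`.
base-frame : ∀ {n k} {s t : Pair n} → Frame k s t → Base n k s → Base n k t
base-frame {n} {k} {s} {t} F S = record
  { b-lower    = λ r j r≤j → trans (F.same-b r j (outside r≤j)) (S.b-lower r j r≤j)
  ; binary     = λ r j → F.binary r j (S.binary r j)
  ; d-lower    = λ r j r<j → trans (F.same-d r j (outside′ r<j)) (S.d-lower r j r<j)
  ; d-nonneg   = λ r j j≢k → subst (0ℤ ≤_) (sym (F.same-d r j (inj₂ j≢k))) (S.d-nonneg r j j≢k)
  ; total      = λ r r<n → trans (total r) (S.total r r<n)
  ; noVertical = λ r j j<k j<r → trans (F.same-d r j (inj₂ (ℕ.<⇒≢ j<k))) (S.noVertical r j j<k j<r)
  ; order      = λ r j k<j r⁺<n j≤r →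
      subst₂ _≤_ (sym (cong₂ _+_ (fall-after (suc r) j k<j) (F.same-d (suc r) j (inj₂ (ℕ.>⇒≢ k<j)))))
        (sym (fall-after r j k<j)) (S.order r j k<j r⁺<n j≤r)
  }
  where
  module F = Frame F
  module S = Base S

  outside : ∀ {r j} → r ℕ.≤ j → r ℕ.< k ⊎ k ℕ.≤ j
  outside {r} r≤j with r ℕ.<? k
  ... | yes r<k = inj₁ r<k
  ... | no r≮k  = inj₂ (ℕ.≤-trans (ℕ.≮⇒≥ r≮k) r≤j)

  outside′ : ∀ {r j} → r ℕ.< j → r ℕ.< k ⊎ j ≢ k
  outside′ {r} r<j with r ℕ.<? k
  ... | yes r<k = inj₁ r<k
  ... | no r≮k  = inj₂ (ℕ.>⇒≢ (ℕ.≤-<-trans (ℕ.≮⇒≥ r≮k) r<j))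

  fall-after : ∀ r j → k ℕ.< j → fall t r j ≡ fall s r j
  fall-after r j k<j = prefix-agree (F.same-sum r) k<j
    (λ l k<l _ → cong₂ _+_ (F.same-b r l (inj₂ (ℕ.<⇒≤ k<l))) (F.same-d r l (inj₂ (ℕ.>⇒≢ k<l))))

  total : ∀ r → fall t r (suc r) ≡ fall s r (suc r)
  total r with r ℕ.<? k
  ... | yes r<k = prefix-cong (suc r) (λ l _ → cong₂ _+_ (F.same-b r l (inj₁ r<k)) (F.same-d r l (inj₁ r<k)))
  ... | no r≮k  = fall-after r (suc r) (s≤s (ℕ.≮⇒≥ r≮k))

fall-flat : ∀ {n} (s : Pair n) r j → (∀ l → l ℕ.< j → drops s r l ≡ 0ℤ) → fall s r j ≡ prefix (bits s r) j
fall-flat s r j flat = prefix-cong j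
  (λ l l<j → trans (cong (λ z → bits s r l + z) (flat l l<j)) (ℤ.+-identityʳ _))

module _ {n k : ℕ} {s : Pair n} (k<n : k ℕ.< n) where
  private
    X : ℕ → ℕ → ℤ
    X r = prefix (bits s r)

  -- No row k-1 can provide N here, and P_k need not be disjoint from P_{k+1}. The number of
  -- horizontal steps of P_k before column j takes over: row k+1 has at most j diagonal steps there,
  -- and for j = k the row sum identifies N with `drops s k k`.
  ordered⇒invariant-first : Ordered n (suc k) s → Invariant n k k s
  ordered⇒invariant-first O = record
    { N          = λ j → + j - X k j
    ; N-zero     = refl
    ; N-mono     = λ j _ → ≤-by₁ (bit≤1 (O.binary k j)) (eq₁ (+ j) (X k j) (bits s k j) (+suc j))
    ; N-last     = ℤ.≤-reflexive (eq₂ (X k k) (drops s k k) (fall≡X k k ℕ.≤-refl ℕ.≤-refl)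
                     (O.b-lower k k ℕ.≤-refl) (O.total k k<n))
    ; done       = λ r k≤r r<k → contradiction k≤r (ℕ.<⇒≱ r<k)
    ; done-last  = λ r k≤r r<k → contradiction k≤r (ℕ.<⇒≱ r<k)
    ; behind     = λ r k≤r r⁺≡k → contradiction k≤r (ℕ.<⇒≱ (ℕ.≤-reflexive r⁺≡k))
    ; ahead      = λ _ j _ → subst (X (suc k) j ≤_) (eq₃ (+ j) (X k j)) (X≤ j)
    ; later      = λ r k<r r⁺<n j j≤k →
        subst₂ _≤_
          (trans (cong₂ _+_ (fall≡X (suc r) j j≤k (ℕ.≤-trans j≤k (ℕ.<⇒≤ (ℕ.m<n⇒m<1+n k<r))))
                   (O.noVertical (suc r) j (s≤s j≤k) (ℕ.≤-<-trans j≤k (ℕ.m<n⇒m<1+n k<r)))) (ℤ.+-identityʳ _))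
          (fall≡X r j j≤k (ℕ.≤-trans j≤k (ℕ.<⇒≤ k<r)))
          (O.order r j k<r r⁺<n (ℕ.≤-trans j≤k (ℕ.<⇒≤ k<r)))
    ; later-flat = λ r k<r _ → O.noVertical r k ℕ.≤-refl k<r
    ; d-nonneg   = λ r → O.d-nonneg r k
    }
    where
    module O = Ordered O

    X≤ : ∀ j → X (suc k) j ≤ + j
    X≤ zero    = ℤ.≤-refl
    X≤ (suc j) = subst (X (suc k) (suc j) ≤_) (sym (+suc j)) (ℤ.+-mono-≤ (X≤ j) (bit≤1 (O.binary (suc k) j)))

    fall≡X : ∀ r j → j ℕ.≤ k → j ℕ.≤ r → fall s r j ≡ X r j
    fall≡X r j j≤k j≤r = fall-flat s r j
      (λ l l<j → O.noVertical r l (ℕ.m<n⇒m<1+n (ℕ.<-≤-trans l<j j≤k)) (ℕ.<-≤-trans l<j j≤r))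

    eq₁ : ∀ p x β {p⁺} → p⁺ ≡ p + 1ℤ → (p⁺ - (x + β)) - (p - x) ≡ 1ℤ - β
    eq₁ p x β refl = solve (p ∷ x ∷ β ∷ [])

    eq₂ : ∀ x δ {p f β} → f ≡ x → β ≡ 0ℤ → f + (β + δ) ≡ p → p - x ≡ δ
    eq₂ x δ refl refl refl = solve (x ∷ δ ∷ [])

    eq₃ : ∀ p x → p ≡ x + (p - x)
    eq₃ p x = solve (p ∷ x ∷ [])

  invariant-first⇒ordered : Base n k s → Invariant n k k s → Ordered n (suc k) s
  invariant-first⇒ordered S I = record
    { b-lower = S.b-lower ; binary = S.binary ; d-lower = S.d-lower ; total = S.total
    ; d-nonneg   = d-nonneg
    ; noVertical = noVertical
    ; order      = order
    }
    where
    module S = Base S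
    module I = Invariant I

    d-nonneg : ∀ r j → 0ℤ ≤ drops s r j
    d-nonneg r j with j ℕ.≟ k
    ... | yes refl = I.d-nonneg r
    ... | no j≢k   = S.d-nonneg r j j≢k

    flat : ∀ r → k ℕ.< r → r ℕ.< n → ∀ j → j ℕ.≤ k → drops s r j ≡ 0ℤ
    flat r k<r r<n j j≤k with ℕ.m≤n⇒m<n∨m≡n j≤k
    ... | inj₁ j<k  = S.noVertical r j j<k (ℕ.<-trans j<k k<r)
    ... | inj₂ refl = I.later-flat r k<r r<n

    noVertical : ∀ r j → j ℕ.< suc k → j ℕ.< r → drops s r j ≡ 0ℤ
    noVertical r j j<k⁺ j<r with ℕ.m≤n⇒m<n∨m≡n (ℕ.s≤s⁻¹ j<k⁺) | r ℕ.<? n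
    ... | inj₁ j<k  | _       = S.noVertical r j j<k j<r
    ... | inj₂ refl | yes r<n = I.later-flat r j<r r<n
    ... | inj₂ refl | no r≮n  = entry-outside (proj₂ s) r j (ℕ.≮⇒≥ r≮n)

    order : ∀ r j → suc k ℕ.≤ r → suc r ℕ.< n → j ℕ.≤ r → fall s (suc r) j + drops s (suc r) j ≤ fall s r j
    order r j k<r r⁺<n j≤r with j ℕ.≤? k
    ... | no j≰k  = S.order r j (ℕ.≰⇒> j≰k) r⁺<n j≤r
    ... | yes j≤k = subst₂ _≤_
      (sym (trans (cong₂ _+_ (fall-flat s (suc r) j (λ l l<j → flat (suc r) k<r⁺ r⁺<n l (l≤k l<j)))
                   (flat (suc r) k<r⁺ r⁺<n j j≤k)) (ℤ.+-identityʳ _)))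
      (sym (fall-flat s r j (λ l l<j → flat r k<r (ℕ.<-trans (ℕ.n<1+n r) r⁺<n) l (l≤k l<j))))
      (I.later r k<r r⁺<n j j≤k)
      where
      k<r⁺ = ℕ.m<n⇒m<1+n k<r
      l≤k : ∀ {l} → l ℕ.< j → l ℕ.≤ k
      l≤k l<j = ℕ.<⇒≤ (ℕ.<-≤-trans l<j j≤k)

module _ {m k : ℕ} {s : Pair (suc m)} where
  private
    X : ℕ → ℕ → ℤ
    X r = prefix (bits s r)

  -- No untangling follows for the last row, so N can be 0, and `behind` reduces to `done`.
  ordered⇒invariant-last : Ordered (suc m) k s → Invariant (suc m) k m s
  ordered⇒invariant-last O = record
    { N          = λ _ → 0ℤ
    ; N-zero     = refl
    ; N-mono     = λ _ _ → ℤ.≤-refl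
    ; N-last     = O.d-nonneg m k
    ; done       = done
    ; done-last  = λ r k≤r r<m → subst₂ _≤_ (cong (_+ drops s (suc r) k) (fall≡X (suc r) k ℕ.≤-refl (ℕ.m≤n⇒m≤1+n k≤r)))
                     (fall≡X r k ℕ.≤-refl k≤r) (O.order r k k≤r (s≤s r<m) k≤r)
    ; behind     = λ { r k≤r refl j j≤k → subst (_≤ X r j) (sym (ℤ.+-identityʳ _)) (done r k≤r ℕ.≤-refl j j≤k) }
    ; ahead      = λ m⁺<m⁺ → contradiction m⁺<m⁺ (ℕ.<-irrefl refl)
    ; later      = λ r m<r r⁺<m⁺ → contradiction r⁺<m⁺ (ℕ.<-asym (s≤s m<r))
    ; later-flat = λ r m<r r<m⁺ → contradiction m<r (ℕ.<⇒≱ r<m⁺)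
    ; d-nonneg   = λ r → O.d-nonneg r k
    }
    where
    module O = Ordered O

    fall≡X : ∀ r j → j ℕ.≤ k → j ℕ.≤ r → fall s r j ≡ X r j
    fall≡X r j j≤k j≤r = fall-flat s r j
      (λ l l<j → O.noVertical r l (ℕ.<-≤-trans l<j j≤k) (ℕ.<-≤-trans l<j j≤r))

    done : ∀ r → k ℕ.≤ r → r ℕ.< m → ∀ j → j ℕ.≤ k → X (suc r) j ≤ X r j
    done r k≤r r<m j j≤k = ≤-by₂ (O.order r j k≤r (s≤s r<m) j≤r) (O.d-nonneg (suc r) j)
      (eq (X (suc r) j) (X r j) (drops s (suc r) j)
        (fall≡X (suc r) j j≤k (ℕ.m≤n⇒m≤1+n j≤r)) (fall≡X r j j≤k j≤r))
      where
      j≤r = ℕ.≤-trans j≤k k≤r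
      eq : ∀ y x δ {y′ x′} → y′ ≡ y → x′ ≡ x → x - y ≡ x′ - (y′ + δ) + (δ - 0ℤ)
      eq y x δ refl refl = solve (y ∷ x ∷ δ ∷ [])

  -- Before column k there are no vertical steps to count and `order` is `done`; in column k it is
  -- `done-last`; beyond, it is part of `Base`.
  invariant-last⇒ordered : Base (suc m) k s → Invariant (suc m) k m s → Ordered (suc m) k s
  invariant-last⇒ordered S I = record
    { b-lower = S.b-lower ; binary = S.binary ; d-lower = S.d-lower ; total = S.total ; noVertical = S.noVertical
    ; d-nonneg   = d-nonneg
    ; order      = order
    }
    where
    module S = Base S
    module I = Invariant I

    d-nonneg : ∀ r j → 0ℤ ≤ drops s r j
    d-nonneg r j with j ℕ.≟ k
    ... | yes refl = I.d-nonneg r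
    ... | no j≢k   = S.d-nonneg r j j≢k

    fall≡X : ∀ r j → j ℕ.≤ k → j ℕ.≤ r → fall s r j ≡ X r j
    fall≡X r j j≤k j≤r = fall-flat s r j
      (λ l l<j → S.noVertical r l (ℕ.<-≤-trans l<j j≤k) (ℕ.<-≤-trans l<j j≤r))

    order : ∀ r j → k ℕ.≤ r → suc r ℕ.< suc m → j ℕ.≤ r → fall s (suc r) j + drops s (suc r) j ≤ fall s r j
    order r j k≤r r⁺<m⁺ j≤r with ℕ.<-cmp j k
    ... | tri> _ _ k<j  = S.order r j k<j r⁺<m⁺ j≤r
    ... | tri≈ _ refl _ = subst₂ _≤_ (cong (_+ drops s (suc r) k) (sym (fall≡X (suc r) k ℕ.≤-refl (ℕ.m≤n⇒m≤1+n k≤r))))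
                            (sym (fall≡X r k ℕ.≤-refl k≤r)) (I.done-last r k≤r (ℕ.s≤s⁻¹ r⁺<m⁺))
    ... | tri< j<k _ _  = subst₂ _≤_
      (sym (trans (cong₂ _+_ (fall≡X (suc r) j (ℕ.<⇒≤ j<k) (ℕ.m≤n⇒m≤1+n j≤r))
                   (S.noVertical (suc r) j j<k (s≤s j≤r))) (ℤ.+-identityʳ _)))
      (sym (fall≡X r j (ℕ.<⇒≤ j<k) j≤r)) (I.done r k≤r (ℕ.s≤s⁻¹ r⁺<m⁺) j (ℕ.<⇒≤ j<k))

-- The loops

-- All chains run in the direction of combing. The uncombing loop builds its chain from the end,
-- prepending one step for each smaller i.
data Chain {m} (k : ℕ) : ℕ → Pair (suc m) → Pair (suc m) → Set where
  stop : ∀ {s} → Chain k m s s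
  step : ∀ {i s t u} → i ℕ.< m → Untangled k i s t → Chain k (suc i) t u → Chain k i s u

chain-functional : ∀ {m k i} {s t u : Pair (suc m)} → Chain k i s t → Chain k i s u → t ≡ u
chain-functional stop            stop           = refl
chain-functional stop            (step m<m _ _) = contradiction m<m (ℕ.<-irrefl refl)
chain-functional (step m<m _ _)  stop           = contradiction m<m (ℕ.<-irrefl refl)
chain-functional (step _ U C)    (step _ V D) with refl ← untangled-functional U V = chain-functional C D

chain-cofunctional : ∀ {m k i} {s t u : Pair (suc m)} → Chain k i s u → Chain k i t u → s ≡ t
chain-cofunctional stop            stop           = refl
chain-cofunctional stop            (step m<m _ _) = contradiction m<m (ℕ.<-irrefl refl)
chain-cofunctional (step m<m _ _)  stop           = contradiction m<m (ℕ.<-irrefl refl)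
chain-cofunctional (step _ U C)    (step _ V D) with refl ← chain-cofunctional C D = untangled-cofunctional U V

chain-frame : ∀ {m k i} {s t : Pair (suc m)} → k ℕ.≤ i → Chain k i s t → Frame k s t
chain-frame k≤i stop         = frame-refl
chain-frame k≤i (step _ U C) = frame-trans (untangled-frame k≤i U) (chain-frame (ℕ.m≤n⇒m≤1+n k≤i) C)

chain-invariant : ∀ {m k i} {s t : Pair (suc m)} → k ℕ.≤ i → Chain k i s t →
                  Invariant (suc m) k i s → Invariant (suc m) k m t
chain-invariant k≤i stop           I = I
chain-invariant k≤i (step i<m U C) I =
  chain-invariant (ℕ.m≤n⇒m≤1+n k≤i) C (invariant-step U k≤i (s≤s i<m) I)

module _ {m} (k : Fin (suc m)) where
  private κ = toℕ k

  -- The invariant is carried along for its `later-flat`, by which row i+1 has no vertical steps in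
  -- column k when its turn comes.
  comb-chain : ∀ t i → i ℕ.+ t ≡ m → κ ℕ.≤ i → ∀ s → (∀ r j → Binary (bits s r j)) →
               Invariant (suc m) κ i s → Chain κ i s (for (from i) (λ i → untangle {m} i k) s)
  comb-chain zero    i eq κ≤i s bin I with refl ← trans (sym (ℕ.+-identityʳ i)) eq
    rewrite from-end m = stop
  comb-chain (suc t) i eq κ≤i s bin I
    with i<m ← subst (i ℕ.<_) eq (ℕ.m<m+n i ℕ.z<s)
    with c ← fromℕ< i<m | refl ← sym (toℕ-fromℕ< i<m)
    rewrite from-∷ c =
    step i<m U (comb-chain t (suc (toℕ c)) (trans (sym (ℕ.+-suc (toℕ c) t)) eq) (ℕ.m≤n⇒m≤1+n κ≤i)
      (untangle c k s) (λ r j → Frame.binary (untangled-frame κ≤i U) r j (bin r j)) (invariant-step U κ≤i (s≤s i<m) I))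
    where
    U : Untangled κ (toℕ c) s (untangle c k s)
    U = Untangle.untangled c k (proj₁ s) (proj₂ s) bin
          (Invariant.later-flat I (suc (toℕ c)) ℕ.≤-refl (s≤s i<m))

updateHeight-here : ∀ {m} (i k : Fin (suc m)) B h →
  (0 ℕ.< toℕ k → at h (toℕ i) ≡ + toℕ i - prefix (entry B (toℕ i)) (toℕ k ℕ.∸ 1)) →
  at (updateHeight i k B h) (toℕ i) ≡ + toℕ i - prefix (entry B (toℕ i)) (toℕ k)
updateHeight-here i Fin.zero    B h init = trans (at-≔ h i (+ toℕ i)) (sym (ℤ.+-identityʳ (+ toℕ i)))
updateHeight-here i (Fin.suc l) B h init = trans (at-≔ h i _)
  (eq (+ toℕ i) (prefix (entry B (toℕ i)) (toℕ l)) (entry B (toℕ i) (toℕ l))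
    (trans (sym (at-lookup h i)) (init ℕ.z<s)) (entry-at B refl (toℕ-inject₁ l)))
  where
  eq : ∀ p x β {u v} → u ≡ p - x → v ≡ β → u - v ≡ p - (x + β)
  eq p x β refl refl = solve (p ∷ x ∷ β ∷ [])

updateHeight-other : ∀ {m} (i k : Fin (suc m)) B h {r} → r ≢ toℕ i → at (updateHeight i k B h) r ≡ at h r
updateHeight-other i Fin.zero    B h r≢i = at-≔-other h i _ r≢i
updateHeight-other i (Fin.suc l) B h r≢i = at-≔-other h i _ r≢i

uncombBody-last : ∀ {m} (k : Fin (suc m)) B D h →
  uncombBody k (fromℕ m) ((B , D) , h) ≡ ((B , D) , updateHeight (fromℕ m) k B h)
uncombBody-last {m} k B D h with m ℕ.≟ toℕ (fromℕ m)
... | yes _  = refl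
... | no m≢m = contradiction (sym (toℕ-fromℕ m)) m≢m

uncombBody-inject₁ : ∀ {m} (k : Fin (suc m)) i B D h →
  uncombBody k (inject₁ i) ((B , D) , h) ≡ cliffify i k ((B , D) , updateHeight (inject₁ i) k B h)
uncombBody-inject₁ {m} k i B D h with m ℕ.≟ toℕ (inject₁ i)
... | yes m≡i = contradiction m≡i (toℕ-inject₁-≢ i)
... | no m≢i  = cong (λ i′ → cliffify i′ k ((B , D) , updateHeight (inject₁ i) k B h)) (lower₁-inject₁′ i m≢i)

module Uncomb {m} (k : Fin (suc m)) (y : Pair (suc m)) (h₀ : Vec ℤ (suc m))
              (binary  : ∀ r j → Binary (bits y r j))
              (inv     : Invariant (suc m) (toℕ k) m y)
              (heights : 0 ℕ.< toℕ k → ∀ r → toℕ k ℕ.≤ r → r ℕ.≤ m →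
                         at h₀ r ≡ + r - prefix (bits y r) (toℕ k ℕ.∸ 1)) where
  private κ = toℕ k

  -- The rows before i are still those of y. `same-h` and `same-b` record this, so that the initial
  -- heights, which are stated for y, apply to each row when it is reached.
  record Reached (i : ℕ) (s : Pair (suc m)) (h : Vec ℤ (suc m)) : Set where
    field
      chain     : Chain κ i s y
      invariant : Invariant (suc m) κ i s
      height    : at h i ≡ + i - prefix (bits s i) κ
      same-h    : ∀ r → r ℕ.< i → at h r ≡ at h₀ r
      same-b    : ∀ r → r ℕ.< i → ∀ j → bits s r j ≡ bits y r j

  run : ℕ → Pair (suc m) × Vec ℤ (suc m)
  run i = for (reverse (from i)) (uncombBody k) (y , h₀)

  ReachedBy : ℕ → Pair (suc m) × Vec ℤ (suc m) → Set
  ReachedBy i (s , h) = Reached i s h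

  run-step : ∀ (c : Fin (suc m)) → run (toℕ c) ≡ uncombBody k c (run (suc (toℕ c)))
  run-step c = begin
    for (reverse (from (toℕ c))) (uncombBody k) (y , h₀)
      ≡⟨ cong (λ l → for (reverse l) (uncombBody k) (y , h₀)) (from-∷ c) ⟩
    for (reverse (c ∷ from (suc (toℕ c)))) (uncombBody k) (y , h₀)
      ≡⟨ cong (λ l → for l (uncombBody k) (y , h₀)) (List.unfold-reverse c (from (suc (toℕ c)))) ⟩
    for (reverse (from (suc (toℕ c))) ∷ʳ c) (uncombBody k) (y , h₀)
      ≡⟨ for-∷ʳ (reverse (from (suc (toℕ c)))) c (uncombBody k) (y , h₀) ⟩
    uncombBody k c (run (suc (toℕ c))) ∎
    where open ≡-Reasoning

  reached-last : κ ℕ.≤ m → ReachedBy m (run m)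
  reached-last κ≤m = subst (ReachedBy m) (sym run-m) record
    { chain     = stop
    ; invariant = inv
    ; height    = subst (λ r → at h₁ r ≡ + r - prefix (bits y r) κ) (toℕ-fromℕ m)
        (updateHeight-here (fromℕ m) k (proj₁ y) h₀
          (λ 0<κ → heights 0<κ (toℕ (fromℕ m)) (subst (κ ℕ.≤_) (sym (toℕ-fromℕ m)) κ≤m) (ℕ.≤-reflexive (toℕ-fromℕ m))))
    ; same-h    = λ r r<m → updateHeight-other (fromℕ m) k (proj₁ y) h₀ (ℕ.<⇒≢ (subst (r ℕ.<_) (sym (toℕ-fromℕ m)) r<m))
    ; same-b    = λ _ _ _ → refl
    }
    where
    h₁ = updateHeight (fromℕ m) k (proj₁ y) h₀
    open ≡-Reasoning
    run-m : run m ≡ (y , h₁)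
    run-m = begin
      run m                                               ≡⟨ cong run (toℕ-fromℕ m) ⟨
      run (toℕ (fromℕ m))                                 ≡⟨ run-step (fromℕ m) ⟩
      uncombBody k (fromℕ m) (run (suc (toℕ (fromℕ m))))  ≡⟨ cong (λ i → uncombBody k (fromℕ m) (run (suc i))) (toℕ-fromℕ m) ⟩
      uncombBody k (fromℕ m) (run (suc m))                ≡⟨ cong (λ l → uncombBody k (fromℕ m) (for (reverse l) (uncombBody k) (y , h₀))) (from-end (suc m)) ⟩
      uncombBody k (fromℕ m) (y , h₀)                     ≡⟨ uncombBody-last k (proj₁ y) (proj₂ y) h₀ ⟩
      (y , h₁)                                            ∎

  -- The invariant at i+1 meets the conditions of `cliffify`: `done` makes the gaps nonnegative and
  -- `done-last` bounds d by the last gap. The `Untangled` so obtained carries the invariant back to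
  -- i.
  reached-step : ∀ (i : Fin m) → κ ℕ.≤ toℕ i → ∀ s h → Reached (suc (toℕ i)) s h →
                 ReachedBy (toℕ i) (cliffify i k (s , updateHeight (inject₁ i) k (proj₁ s) h))
  reached-step i κ≤i s h R = record
    { chain     = step (toℕ<n i) U R.chain
    ; invariant = invariant-unstep U κ≤i R.invariant
    ; height    = trans C.height-upper
        (eq (+ ι) (prefix (bits s′ ι) κ) (Untangled.M U κ) h₁-upper
          (prefix-upper (Untangled.M-zero U) (Untangled.columns U) κ ℕ.≤-refl) (Untangled.d-moved U))
    ; same-h    = λ r r<i → trans (C.height-other r (ℕ.<⇒≢ r<i , ℕ.<⇒≢ (ℕ.m<n⇒m<1+n r<i)))
        (trans (updateHeight-other (inject₁ i) k (proj₁ s) h (λ r≡ → ℕ.<⇒≢ r<i (trans r≡ i≡)))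
          (R.same-h r (ℕ.m<n⇒m<1+n r<i)))
    ; same-b    = λ r r<i j → trans (sym (Untangled.same-b U r j (inj₁ (ℕ.<⇒≢ r<i , ℕ.<⇒≢ (ℕ.m<n⇒m<1+n r<i)))))
        (R.same-b r (ℕ.m<n⇒m<1+n r<i) j)
    }
    where
    module R = Reached R
    module I = Invariant R.invariant
    ι = toℕ i
    i≡ = toℕ-inject₁ i
    h₁ = updateHeight (inject₁ i) k (proj₁ s) h
    module C = Cliffify i k (proj₁ s) (proj₂ s) h₁
    s′ = proj₁ (cliffify i k (s , h₁))

    h₁-upper : at h₁ ι ≡ + ι - prefix (bits s ι) κ
    h₁-upper = subst (λ r → at h₁ r ≡ + r - prefix (bits s r) κ) i≡
      (updateHeight-here (inject₁ i) k (proj₁ s) h (λ 0<κ →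
        subst (λ r → at h r ≡ + r - prefix (bits s r) (κ ℕ.∸ 1)) (sym i≡)
          (trans (R.same-h ι ℕ.≤-refl)
            (trans (heights 0<κ ι κ≤i (ℕ.<⇒≤ (toℕ<n i)))
              (cong (λ z → + ι - z) (prefix-cong (κ ℕ.∸ 1) (λ l _ → sym (R.same-b ι ℕ.≤-refl l))))))))

    h₁-lower : at h₁ (suc ι) ≡ + suc ι - prefix (bits s (suc ι)) κ
    h₁-lower = trans (updateHeight-other (inject₁ i) k (proj₁ s) h (λ i⁺≡ → ℕ.1+n≢n (trans i⁺≡ i≡))) R.height

    U : Untangled κ ι s′ s
    U = C.untangled
      (λ r j → Frame.binary⁻¹ (chain-frame (ℕ.m≤n⇒m≤1+n κ≤i) R.chain) r j (binary r j))
      h₁-upper h₁-lower (I.d-nonneg (suc ι))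
      (≤-by₁ (I.done-last ι κ≤i ℕ.≤-refl) (eq′ (prefix (bits s ι) κ) (prefix (bits s (suc ι)) κ) (drops s (suc ι) κ)))
      (λ j j≤κ → ℤ.i≤j⇒0≤j-i (I.done ι κ≤i ℕ.≤-refl j j≤κ))
      where
      eq′ : ∀ x y d → (x - y) - d ≡ x - (y + d)
      eq′ x y d = solve (x ∷ y ∷ d ∷ [])

    eq : ∀ p x m {h x′ d} → h ≡ p - x′ → x′ ≡ x + m → d ≡ m → h + d ≡ p - x
    eq p x m refl refl refl = solve (p ∷ x ∷ m ∷ [])

  reached : ∀ t i → i ℕ.+ t ≡ m → κ ℕ.≤ i → ReachedBy i (run i)
  reached zero    i eq κ≤i with refl ← trans (sym (ℕ.+-identityʳ i)) eq = reached-last κ≤i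
  reached (suc t) i eq κ≤i
    with i<m ← subst (i ℕ.<_) eq (ℕ.m<m+n i ℕ.z<s)
    with c ← fromℕ< i<m | refl ← sym (toℕ-fromℕ< i<m) =
    subst (ReachedBy (toℕ c)) (sym run-c)
      (reached-step c κ≤i (proj₁ (run (suc (toℕ c)))) (proj₂ (run (suc (toℕ c))))
        (reached t (suc (toℕ c)) (trans (sym (ℕ.+-suc (toℕ c) t)) eq) (ℕ.m≤n⇒m≤1+n κ≤i)))
    where
    open ≡-Reasoning
    s = proj₁ (run (suc (toℕ c)))
    h = proj₂ (run (suc (toℕ c)))
    run-c : run (toℕ c) ≡ cliffify c k (s , updateHeight (inject₁ c) k (proj₁ s) h)
    run-c = begin
      run (toℕ c)                                               ≡⟨ cong run (toℕ-inject₁ c) ⟨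
      run (toℕ (inject₁ c))                                     ≡⟨ run-step (inject₁ c) ⟩
      uncombBody k (inject₁ c) (run (suc (toℕ (inject₁ c))))    ≡⟨ cong (λ i → uncombBody k (inject₁ c) (run (suc i))) (toℕ-inject₁ c) ⟩
      uncombBody k (inject₁ c) (run (suc (toℕ c)))              ≡⟨ uncombBody-inject₁ k c (proj₁ s) (proj₂ s) h ⟩
      cliffify c k (s , updateHeight (inject₁ c) k (proj₁ s) h) ∎

-- Paths

data Crossing : Kind → ℤ → Set where
  horizontal : Crossing horizontal 0ℤ
  diagonal   : Crossing diagonal 1ℤ

private
  from-difference : ∀ a x {d} → a - x ≡ d → a ≡ x + d
  from-difference a x refl = solve (a ∷ x ∷ [])

crossing-target : ∀ {s β x c q} → Crossing s β → q ⊖ (x , + c) ≡ displacement s → q ≡ (x - β , + suc c)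
crossing-target {x = x} {c} {a , b} horizontal eq = cong₂ _,_
  (from-difference a x (cong proj₁ eq)) (trans (from-difference b (+ c) (cong proj₂ eq)) (sym (+suc c)))
crossing-target {x = x} {c} {a , b} diagonal eq = cong₂ _,_
  (from-difference a x (cong proj₁ eq)) (trans (from-difference b (+ c) (cong proj₂ eq)) (sym (+suc c)))

vertical-target : ∀ {x c q} → q ⊖ (x , + c) ≡ displacement vertical → q ≡ (x - 1ℤ , + c)
vertical-target {x} {c} {a , b} eq = cong₂ _,_
  (from-difference a x (cong proj₁ eq)) (trans (from-difference b (+ c) (cong proj₂ eq)) (ℤ.+-identityʳ (+ c)))

private
  difference : ∀ x d → x + d - x ≡ d
  difference x d = solve (x ∷ d ∷ [])

  minus≤ : ∀ x v → x - + v ≤ x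
  minus≤ x v = ≤-by₁ (+≤+ (z≤n {v})) (eq x (+ v))
    where
    eq : ∀ x v → x - (x - v) ≡ v - 0ℤ
    eq x v = solve (x ∷ v ∷ [])

  minus-suc : ∀ x v → x - 1ℤ - + v ≡ x - + suc v
  minus-suc x v = eq x (+ v) (+suc v)
    where
    eq : ∀ x v {v′} → v′ ≡ v + 1ℤ → x - 1ℤ - v ≡ x - v′
    eq x v refl = solve (x ∷ v ∷ [])

crossing-displacement : ∀ {s β} x c → Crossing s β → (x - β , + suc c) ⊖ (x , + c) ≡ displacement s
crossing-displacement x c horizontal = cong₂ _,_ (difference x 0ℤ) (trans (cong (_- + c) (+suc c)) (difference (+ c) 1ℤ))
crossing-displacement x c diagonal   = cong₂ _,_ (difference x -1ℤ) (trans (cong (_- + c) (+suc c)) (difference (+ c) 1ℤ))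

vertical-step : ∀ x c → Step (x , + c) (x - 1ℤ , + c)
vertical-step x c = vertical , cong₂ _,_ (difference x -1ℤ) (ℤ.+-inverseʳ (+ c))

crossing≢vertical : ∀ {s β} → Crossing s β → vertical ≢ s
crossing≢vertical horizontal ()
crossing≢vertical diagonal   ()

step-column : ∀ p q → Step p q → column p ≤ column q
step-column p q (s , eq) = ≤-by₀ (subst (0ℤ ≤_) (sym (cong proj₂ eq)) (nonneg s))
  where
  nonneg : ∀ s → 0ℤ ≤ column (displacement s)
  nonneg horizontal = 0≤1
  nonneg diagonal   = 0≤1
  nonneg vertical   = ℤ.≤-refl

path-column : ∀ {p q} → Path p q → column p ≤ column q
path-column ε       = ℤ.≤-refl
path-column (_◅_ {p} {q} s P) = ℤ.≤-trans (step-column p q s) (path-column P)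

steps-column : ∀ {p q} (P : Path p q) {s j} → (s , j) ∈ steps P → column p ≤ j
steps-column (_ ◅ P) (here refl) = ℤ.≤-refl
steps-column (_◅_ {p} {q} s P) (there mem) = ℤ.≤-trans (step-column p q s) (steps-column P mem)

no-step-before : ∀ {x c q} (P : Path (x , + suc c) q) {s} → ¬ (s , + c) ∈ steps P
no-step-before {c = c} P mem = ℕ.<-irrefl refl (ℤ.drop‿+≤+ (steps-column P mem))

verticalSteps-before : ∀ {x c q} (P : Path (x , + suc c) q) → verticalSteps P (+ c) ≡ 0
verticalSteps-before {c = c} P = cong length
  (List.filter-none (≡-dec _≟ᴷ_ _≟_ (vertical , + c)) (All.tabulate λ { mem refl → no-step-before P mem }))

verticalSteps-here : ∀ {x c q r} (eq : q ⊖ (x , + c) ≡ displacement vertical) (P : Path q r) →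
                     verticalSteps {x , + c} ((vertical , eq) ◅ P) (+ c) ≡ suc (verticalSteps P (+ c))
verticalSteps-here {c = c} eq P = cong length (List.filter-accept (≡-dec _≟ᴷ_ _≟_ (vertical , + c)) refl)

verticalSteps-other : ∀ {p q r s} (eq : q ⊖ p ≡ displacement s) (P : Path q r) {j} →
                      (vertical , j) ≢ (s , column p) → verticalSteps {p} ((s , eq) ◅ P) j ≡ verticalSteps P j
verticalSteps-other {s = s} eq P {j} ≢ = cong length (List.filter-reject (≡-dec _≟ᴷ_ _≟_ (vertical , j)) ≢)

module _ (b top bot : ℕ → ℤ) where

  Crosses : ∀ {p q} → Path p q → ℕ → Set
  Crosses P j = (horizontal , + j) ∈ steps P × b j ≡ 0ℤ ⊎ (diagonal , + j) ∈ steps P × b j ≡ 1ℤ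

  Crosses-there : ∀ {p q r} (s : Step p q) (P : Path q r) {j} →
                  (∀ {s′ β} → Crossing s′ β → (s′ , + j) ≢ (proj₁ s , column p)) → Crosses (s ◅ P) j → Crosses P j
  Crosses-there s P ≢ (inj₁ (here eq , _))   = contradiction eq (≢ horizontal)
  Crosses-there s P ≢ (inj₁ (there mem , e)) = inj₁ (mem , e)
  Crosses-there s P ≢ (inj₂ (here eq , _))   = contradiction eq (≢ diagonal)
  Crosses-there s P ≢ (inj₂ (there mem , e)) = inj₂ (mem , e)

  -- The other alternative would need a second step out of column c, which the rest of the path has
  -- already left.
  crosses-bit : ∀ {s β x c r} → Crossing s β → (eq : (x - β , + suc c) ⊖ (x , + c) ≡ displacement s) →
                (P : Path (x - β , + suc c) r) → Crosses {x , + c} ((s , eq) ◅ P) c → b c ≡ β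
  crosses-bit horizontal eq P (inj₁ (_ , e))       = e
  crosses-bit horizontal eq P (inj₂ (there mem , _)) = contradiction mem (no-step-before P)
  crosses-bit diagonal   eq P (inj₂ (_ , e))       = e
  crosses-bit diagonal   eq P (inj₁ (there mem , _)) = contradiction mem (no-step-before P)

  crosses-here : ∀ {s β p q} {P : Path p q} {j} → Crossing s β → b j ≡ β → (s , + j) ∈ steps P → Crosses P j
  crosses-here horizontal e mem = inj₁ (mem , e)
  crosses-here diagonal   e mem = inj₂ (mem , e)

  -- The start column c is kept apart because, in the induction, the path may begin at a point x
  -- part of the way down it.
  record Covers {p q} (P : Path p q) (x : ℤ) (c e : ℕ) : Set where
    field
      first : ∀ z → bot c ≤ z → z ≤ x → (z , + c) ∈ support P
      rest  : ∀ j → c ℕ.< j → j ℕ.≤ e → ∀ z → bot j ≤ z → z ≤ top j → (z , + j) ∈ support P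
      end   : proj₁ q ≡ bot e

  module _ (top-suc : ∀ j → top (suc j) ≡ bot j - b j) where

    covers : ∀ {x c y e} (P : Path (x , + c) (y , + e)) →
             (∀ j → c ℕ.≤ j → j ℕ.< e → Crosses P j) →
             x - + verticalSteps P (+ c) ≡ bot c →
             (∀ j → c ℕ.< j → j ℕ.≤ e → top j - + verticalSteps P (+ j) ≡ bot j) →
             Covers P x c e

    covers-crossing : ∀ {s β x c y e} → Crossing s β → (eq : (x - β , + suc c) ⊖ (x , + c) ≡ displacement s) →
                      (P : Path (x - β , + suc c) (y , + e)) →
                      (∀ j → c ℕ.≤ j → j ℕ.< e → Crosses {x , + c} ((s , eq) ◅ P) j) →
                      x - + verticalSteps {x , + c} ((s , eq) ◅ P) (+ c) ≡ bot c →
                      (∀ j → c ℕ.< j → j ℕ.≤ e → top j - + verticalSteps {x , + c} ((s , eq) ◅ P) (+ j) ≡ bot j) →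
                      Covers ((s , eq) ◅ P) x c e
    covers-crossing {s} {β} {x} {c} {y} {e} κ eq P cross h₀ h = record
      { first = λ z bot≤z z≤x → here (cong (_, + c) (ℤ.≤-antisym z≤x (subst (_≤ z) bot≡x bot≤z)))
      ; rest  = rest
      ; end   = C.end
      }
      where
      same : ∀ j → verticalSteps {x , + c} ((s , eq) ◅ P) j ≡ verticalSteps P j
      same j = verticalSteps-other {s = s} eq P {j} (crossing≢vertical κ ∘ cong proj₁)

      -- After the crossing no vertical step of column c can follow, so the crossing starts where
      -- the column is left.
      bot≡x : bot c ≡ x
      bot≡x = trans (sym h₀) (trans (cong (λ v → x - + v) (trans (same (+ c)) (verticalSteps-before P))) (ℤ.+-identityʳ x))

      c<e : c ℕ.< e
      c<e = ℤ.drop‿+≤+ (path-column P)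

      top≡ : top (suc c) ≡ x - β
      top≡ = trans (top-suc c) (cong₂ _-_ bot≡x (crosses-bit {x = x} κ eq P (cross c ℕ.≤-refl c<e)))

      module C = Covers (covers P
        (λ j c<j j<e → Crosses-there (s , eq) P
          (λ _ j≡ → ℕ.<⇒≢ c<j (sym (ℤ.+-injective (cong proj₂ j≡)))) (cross j (ℕ.<⇒≤ c<j) j<e))
        (trans (cong₂ (λ t v → t - + v) (sym top≡) (sym (same (+ suc c)))) (h (suc c) ℕ.≤-refl c<e))
        (λ j c⁺<j j≤e → trans (cong (λ v → top j - + v) (sym (same (+ j)))) (h j (ℕ.<-trans (ℕ.n<1+n c) c⁺<j) j≤e)))

      rest : ∀ j → c ℕ.< j → j ℕ.≤ e → ∀ z → bot j ≤ z → z ≤ top j → (z , + j) ∈ support ((s , eq) ◅ P)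
      rest j c<j j≤e z bot≤z z≤top with ℕ.m≤n⇒m<n∨m≡n c<j
      ... | inj₁ c⁺<j = there (C.rest j c⁺<j j≤e z bot≤z z≤top)
      ... | inj₂ refl = there (C.first z bot≤z (subst (z ≤_) top≡ z≤top))

    covers {x} {c} ε cross h₀ h = record
      { first = λ z bot≤z z≤x → here (cong (_, + c) (ℤ.≤-antisym z≤x (subst (_≤ z) bot≡x bot≤z)))
      ; rest  = λ j c<j j≤c → contradiction j≤c (ℕ.<⇒≱ c<j)
      ; end   = sym bot≡x
      }
      where
      bot≡x : bot c ≡ x
      bot≡x = trans (sym h₀) (ℤ.+-identityʳ x)
    covers {x} {c} (_◅_ {j = q} (horizontal , eq) P) cross h₀ h
      with refl ← crossing-target {x = x} {c} {q} horizontal eq =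
      covers-crossing horizontal eq P cross h₀ h
    covers {x} {c} (_◅_ {j = q} (diagonal , eq) P) cross h₀ h
      with refl ← crossing-target {x = x} {c} {q} diagonal eq =
      covers-crossing diagonal eq P cross h₀ h
    covers {x} {c} {y} {e} (_◅_ {j = q} (vertical , eq) P) cross h₀ h
      with refl ← vertical-target {x} {c} {q} eq = record
      { first = first
      ; rest  = λ j c<j j≤e z bot≤z z≤top → there (C.rest j c<j j≤e z bot≤z z≤top)
      ; end   = C.end
      }
      where
      module C = Covers (covers P
        (λ j c≤j j<e → Crosses-there (vertical , eq) P
          (λ κ j≡ → crossing≢vertical κ (sym (cong proj₁ j≡))) (cross j c≤j j<e))
        (trans (trans (minus-suc x _) (cong (λ v → x - + v) (sym (verticalSteps-here eq P)))) h₀)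
        (λ j c<j j≤e → trans (cong (λ v → top j - + v) (sym (verticalSteps-other {s = vertical} eq P
            (λ j≡ → ℕ.<⇒≢ c<j (sym (ℤ.+-injective (cong proj₂ j≡))))))) (h j c<j j≤e)))

      first : ∀ z → bot c ≤ z → z ≤ x → (z , + c) ∈ support {x , + c} ((vertical , eq) ◅ P)
      first z bot≤z z≤x with z ≟ x
      ... | yes refl = here refl
      ... | no z≢x   = there (C.first z bot≤z (≤-by₁ (<⇒+1≤ (ℤ.≤∧≢⇒< z≤x z≢x)) (eq₂ x z)))
        where
        eq₂ : ∀ x z → x - 1ℤ - z ≡ x - (z + 1ℤ)
        eq₂ x z = solve (x ∷ z ∷ [])

  module _ (w : ℕ → ℕ) (binary : ∀ j → Binary (b j))
           (bot≡ : ∀ j → bot j ≡ top j - + w j) (top-suc : ∀ j → top (suc j) ≡ bot j - b j) where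

    -- v is the number of vertical steps still to be made in the start column c. `within` is the
    -- converse of `Covers`: no point lies outside the intervals from `bot` to `top`.
    record Traces (e : ℕ) {p q} (P : Path p q) (c v : ℕ) : Set where
      field
        crosses : ∀ j → c ℕ.≤ j → j ℕ.< e → Crosses P j
        vertical₀    : verticalSteps P (+ c) ≡ v
        verticals   : ∀ j → c ℕ.< j → j ℕ.≤ e → verticalSteps P (+ j) ≡ w j
        within  : ∀ {p} → p ∈ support P →
                  ∃[ j ] column p ≡ + j × j ℕ.≤ e × bot j ≤ proj₁ p × proj₁ p ≤ top j

    private
      bit-crossing : ∀ {β} → Binary β → ∃[ s ] Crossing s β
      bit-crossing (inj₁ refl) = horizontal , horizontal
      bit-crossing (inj₂ refl) = diagonal , diagonal

      crossing-top : ∀ {x c} → x - 0ℤ ≡ bot c → x - b c ≡ top (suc c)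
      crossing-top {x} {c} x≡ = trans (cong (_- b c) (trans (sym (ℤ.+-identityʳ x)) x≡)) (sym (top-suc c))

    traces-crossing : ∀ {s x c y e} (κ : Crossing s (b c)) → c ℕ.≤ e → x ≡ bot c → x ≤ top c →
                      (P : Path (x - b c , + suc c) (y , + e)) → Traces e P (suc c) (w (suc c)) →
                      Traces e ((s , crossing-displacement x c κ) ◅ P) c 0
    traces-crossing {s} {x} {c} {y} {e} κ c≤e x≡bot x≤top P T = record
      { crosses    = crosses
      ; vertical₀  = trans (same (+ c)) (verticalSteps-before P)
      ; verticals  = verticals
      ; within     = λ { (here refl) → c , refl , c≤e , ℤ.≤-reflexive (sym x≡bot) , x≤top
                       ; (there mem) → T.within mem }
      }
      where
      module T = Traces T
      P⁺ : Path (x , + c) (y , + e)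
      P⁺ = (s , crossing-displacement x c κ) ◅ P
      same : ∀ j → verticalSteps P⁺ j ≡ verticalSteps P j
      same j = verticalSteps-other {s = s} (crossing-displacement x c κ) P {j} (crossing≢vertical κ ∘ cong proj₁)
      crosses : ∀ j → c ℕ.≤ j → j ℕ.< e → Crosses P⁺ j
      crosses j c≤j j<e with ℕ.m≤n⇒m<n∨m≡n c≤j
      ... | inj₁ c<j  = Data.Sum.map (map₁ there) (map₁ there) (T.crosses j c<j j<e)
      ... | inj₂ refl = crosses-here {P = P⁺} κ refl (here refl)
      verticals : ∀ j → c ℕ.< j → j ℕ.≤ e → verticalSteps P⁺ (+ j) ≡ w j
      verticals j c<j j≤e with ℕ.m≤n⇒m<n∨m≡n c<j
      ... | inj₁ c⁺<j = trans (same (+ j)) (T.verticals j c⁺<j j≤e)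
      ... | inj₂ refl = trans (same (+ j)) T.vertical₀

    -- Recursion on the number t of columns still to be crossed and, inside a column, on the number
    -- v of vertical steps left before the crossing.
    trace : ∀ {y e} → y ≡ bot e → ∀ t v c x → c ℕ.+ t ≡ e → x - + v ≡ bot c → x ≤ top c →
            ∃[ P ] Traces e {x , + c} {y , + e} P c v
    trace {y} {e} y≡ zero zero c x c≡ x≡ x≤top
      with refl ← trans (sym (ℕ.+-identityʳ c)) c≡
      with refl ← trans y≡ (trans (sym x≡) (ℤ.+-identityʳ x)) = ε , record
      { crosses = λ j c≤j j<c → contradiction c≤j (ℕ.<⇒≱ j<c)
      ; vertical₀    = refl
      ; verticals   = λ j c<j j≤c → contradiction j≤c (ℕ.<⇒≱ c<j)
      ; within  = λ { (here refl) → c , refl , ℕ.≤-refl , ℤ.≤-reflexive (sym y≡) , x≤top }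
      }
    trace {y} {e} y≡ t (suc v) c x c≡ x≡ x≤top
      with P , T ← trace {y} {e} y≡ t v c (x - 1ℤ) c≡ (trans (minus-suc x v) x≡) (ℤ.≤-trans (minus≤ x 1) x≤top) =
      vertical-step x c ◅ P , record
      { crosses = λ j c≤j j<e → Data.Sum.map (map₁ there) (map₁ there) (T.crosses j c≤j j<e)
      ; vertical₀    = trans (verticalSteps-here (proj₂ (vertical-step x c)) P) (cong suc T.vertical₀)
      ; verticals   = λ j c<j j≤e → trans (verticalSteps-other {s = vertical} (proj₂ (vertical-step x c)) P
                    (λ j≡ → ℕ.<⇒≢ c<j (sym (ℤ.+-injective (cong proj₂ j≡))))) (T.verticals j c<j j≤e)
      ; within  = λ { (here refl) → c , refl , subst (c ℕ.≤_) c≡ (ℕ.m≤m+n c t) , subst (_≤ x) x≡ (minus≤ x (suc v)) , x≤top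
                    ; (there mem) → T.within mem }
      }
      where
      module T = Traces T
    trace {y} {e} y≡ (suc t) zero c x c≡ x≡ x≤top
      with s , κ ← bit-crossing (binary c)
      with P , T ← trace {y} {e} y≡ t (w (suc c)) (suc c) (x - b c) (trans (sym (ℕ.+-suc c t)) c≡)
                     (trans (cong (_- + w (suc c)) (crossing-top {x} {c} x≡)) (sym (bot≡ (suc c))))
                     (ℤ.≤-reflexive (crossing-top {x} {c} x≡)) =
      (s , crossing-displacement x c κ) ◅ P ,
      traces-crossing κ (subst (c ℕ.≤_) c≡ (ℕ.m≤m+n c (suc t))) (trans (sym (ℤ.+-identityʳ x)) x≡) x≤top P T

-- Disjoint families as inequalities between matrix entries

module _ {n : ℕ} (s : Pair n) where

  -- The first coordinates at which P_r enters and leaves column j.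
  top bot : ℕ → ℕ → ℤ
  top r j = + r - fall s r j
  bot r j = top r j - drops s r j

  top-suc : ∀ r j → top r (suc j) ≡ bot r j - bits s r j
  top-suc r j = eq (+ r) (fall s r j) (bits s r j) (drops s r j)
    where
    eq : ∀ p f β δ → p - (f + (β + δ)) ≡ p - f - δ - β
    eq p f β δ = solve (p ∷ f ∷ β ∷ δ ∷ [])

  nonneg⇒bot≤top : ∀ r j → 0ℤ ≤ drops s r j → bot r j ≤ top r j
  nonneg⇒bot≤top r j 0≤d = ≤-by₁ 0≤d (eq (top r j) (drops s r j))
    where
    eq : ∀ t δ → t - (t - δ) ≡ δ - 0ℤ
    eq t δ = solve (t ∷ δ ∷ [])

module _ {n k : ℕ} {s : Pair n} where

  pathfam⇒ordered : Pathfamₖ n k s → Ordered n k s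
  pathfam⇒ordered F = record
    { b-lower    = b-lower
    ; binary     = entry-all B (λ _ _ → Binary) (λ _ _ → inj₁ refl) F.B-binary
    ; d-lower    = entry-all D (λ r j x → r ℕ.< j → x ≡ 0ℤ) (λ _ _ _ → refl) F.D-weaklyLower
    ; d-nonneg   = d-nonneg
    ; total      = total
    ; noVertical = entry-all D (λ r j x → j ℕ.< k → j ℕ.< r → x ≡ 0ℤ) (λ _ _ _ _ → refl) F.noVertical
    ; order      = λ r j k≤r r⁺<n j≤r → ≤-by₁ (above r k≤r r⁺<n j j≤r)
        (eq₁ (+ r) (fall s r j) (fall s (suc r) j) (drops s (suc r) j) (+suc r))
    }
    where
    module F where
      open Pathfamₖ F public
      open Pathfam pathfam public
      open Encodes encodes public
    B = proj₁ s
    D = proj₂ s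

    b-lower : ∀ r j → r ℕ.≤ j → bits s r j ≡ 0ℤ
    b-lower = entry-all B (λ r j x → r ℕ.≤ j → x ≡ 0ℤ) (λ _ _ _ → refl) F.B-strictlyLower

    d-nonneg : ∀ r j → 0ℤ ≤ drops s r j
    d-nonneg = entry-all D (λ _ _ → 0ℤ ≤_) (λ _ _ → ℤ.≤-refl) F.D-natural

    vertical≡ : ∀ i j → j ℕ.≤ toℕ i → + verticalSteps (F.family i) (+ j) ≡ drops s (toℕ i) j
    vertical≡ i j j≤i = subst (λ j → + verticalSteps (F.family i) (+ j) ≡ drops s (toℕ i) j) (toℕ-fromℕ< j<n)
      (trans (sym (F.D-entries i c (subst (ℕ._≤ toℕ i) (sym (toℕ-fromℕ< j<n)) j≤i))) (sym (entry-lookup D i c)))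
      where
      j<n = ℕ.≤-<-trans j≤i (toℕ<n i)
      c = fromℕ< j<n

    crosses : ∀ i j → j ℕ.< toℕ i → Crosses (bits s (toℕ i)) (top s (toℕ i)) (bot s (toℕ i)) (F.family i) j
    crosses i j j<i = subst (Crosses (bits s (toℕ i)) (top s (toℕ i)) (bot s (toℕ i)) (F.family i)) (toℕ-fromℕ< j<n)
      (Data.Sum.map (λ (p , e) → p , trans (entry-lookup B i c) e) (λ (p , e) → p , trans (entry-lookup B i c) e)
        (F.B-entries i c (subst (ℕ._< toℕ i) (sym (toℕ-fromℕ< j<n)) j<i)))
      where
      j<n = ℕ.<-trans j<i (toℕ<n i)
      c = fromℕ< j<n

    cover : ∀ i → Covers (bits s (toℕ i)) (top s (toℕ i)) (bot s (toℕ i)) (F.family i) (+ toℕ i) 0 (toℕ i)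
    cover i = covers _ _ _ (top-suc s (toℕ i)) (F.family i) (λ j _ → crosses i j)
      (cong₂ _-_ (sym (ℤ.+-identityʳ (+ toℕ i))) (vertical≡ i 0 z≤n))
      (λ j _ j≤i → cong (λ v → top s (toℕ i) j - v) (vertical≡ i j j≤i))

    -- The path ends at (0, r), so it leaves column r at first coordinate 0.
    total : ∀ r → r ℕ.< n → fall s r (suc r) ≡ + r
    total r r<n = eq (+ r) (fall s r r) (drops s r r) (b-lower r r ℕ.≤-refl)
      (subst (λ r → 0ℤ ≡ bot s r r) (toℕ-fromℕ< r<n) (Covers.end (cover (fromℕ< r<n))))
      where
      eq : ∀ p f δ {β} → β ≡ 0ℤ → 0ℤ ≡ p - f - δ → f + (β + δ) ≡ p
      eq p f δ refl e = begin
        f + (0ℤ + δ)               ≡⟨ ℤ.+-identityʳ _ ⟨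
        f + (0ℤ + δ) + 0ℤ          ≡⟨ cong (λ z → f + (0ℤ + δ) + z) e ⟩
        f + (0ℤ + δ) + (p - f - δ) ≡⟨ solve (p ∷ f ∷ δ ∷ []) ⟩
        p                          ∎
        where open ≡-Reasoning

    on-path : ∀ i j → j ℕ.≤ toℕ i → ∀ z → bot s (toℕ i) j ≤ z → z ≤ top s (toℕ i) j → (z , + j) ∈ support (F.family i)
    on-path i zero    j≤i z bot≤z z≤top = Covers.first (cover i) z bot≤z (subst (z ≤_) (ℤ.+-identityʳ (+ toℕ i)) z≤top)
    on-path i (suc j) j≤i z bot≤z z≤top = Covers.rest (cover i) (suc j) ℕ.z<s j≤i z bot≤z z≤top

    meet : ∀ r → k ℕ.≤ r → suc r ℕ.< n → ∀ j → j ℕ.≤ r → ∀ z →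
           bot s r j ≤ z → z ≤ top s r j → bot s (suc r) j ≤ z → ¬ z ≤ top s (suc r) j
    meet r k≤r r⁺<n j j≤r z p q p′ q′ =
      F.disjoint i i′ (subst (k ℕ.≤_) (sym i≡) k≤r) (subst (k ℕ.≤_) (sym i′≡) (ℕ.m≤n⇒m≤1+n k≤r))
        (λ i≡i′ → ℕ.1+n≢n (trans (sym i′≡) (trans (cong toℕ (sym i≡i′)) i≡))) (z , + j)
        ( on-path i j (subst (j ℕ.≤_) (sym i≡) j≤r) z (subst (λ r → bot s r j ≤ z) (sym i≡) p) (subst (λ r → z ≤ top s r j) (sym i≡) q)
        , on-path i′ j (subst (j ℕ.≤_) (sym i′≡) (ℕ.m≤n⇒m≤1+n j≤r)) z
            (subst (λ r → bot s r j ≤ z) (sym i′≡) p′) (subst (λ r → z ≤ top s r j) (sym i′≡) q′) )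
      where
      r<n = ℕ.<-trans (ℕ.n<1+n r) r⁺<n
      i = fromℕ< r<n
      i′ = fromℕ< r⁺<n
      i≡ = toℕ-fromℕ< r<n
      i′≡ = toℕ-fromℕ< r⁺<n

    bot≤top : ∀ r j → bot s r j ≤ top s r j
    bot≤top r j = nonneg⇒bot≤top s r j (d-nonneg r j)

    eq₁ : ∀ p f f⁺ δ⁺ {p⁺} → p⁺ ≡ p + 1ℤ → f - (f⁺ + δ⁺) ≡ p⁺ - f⁺ - δ⁺ - (p - f + 1ℤ)
    eq₁ p f f⁺ δ⁺ refl = solve (p ∷ f ∷ f⁺ ∷ δ⁺ ∷ [])

    -- Two disjoint paths cannot change sides: crossing into the next column
    -- moves them by at most one, so they would have to meet.
    above : ∀ r → k ℕ.≤ r → suc r ℕ.< n → ∀ j → j ℕ.≤ r → top s r j + 1ℤ ≤ bot s (suc r) j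
    enters-above : ∀ r → k ℕ.≤ r → suc r ℕ.< n → ∀ j → j ℕ.≤ r → top s r j + 1ℤ ≤ top s (suc r) j

    above r k≤r r⁺<n j j≤r with bot s (suc r) j ℤ.≤? top s r j
    ... | no bot≰top = <⇒+1≤ (ℤ.≰⇒> bot≰top)
    ... | yes bot≤top′ = contradiction (ℤ.≤-trans (ℤ.i≤i+j (top s r j) 1ℤ) (enters-above r k≤r r⁺<n j j≤r))
      (meet r k≤r r⁺<n j j≤r (top s r j) (bot≤top r j) ℤ.≤-refl bot≤top′)

    enters-above r k≤r r⁺<n zero j≤r = ℤ.≤-reflexive (eq (+ r) (+suc r))
      where
      eq : ∀ p {p⁺} → p⁺ ≡ p + 1ℤ → p - 0ℤ + 1ℤ ≡ p⁺ - 0ℤ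
      eq p refl = solve (p ∷ [])
    enters-above r k≤r r⁺<n (suc j) j<r = <⇒+1≤ (ℤ.≤∧≢⇒< weak λ eq →
      meet r k≤r r⁺<n (suc j) j<r (top s r (suc j)) (bot≤top r (suc j)) ℤ.≤-refl
        (subst (bot s (suc r) (suc j) ≤_) (sym eq) (bot≤top (suc r) (suc j))) (ℤ.≤-reflexive eq))
      where
      binary = entry-all B (λ _ _ → Binary) (λ _ _ → inj₁ refl) F.B-binary
      weak : top s r (suc j) ≤ top s (suc r) (suc j)
      weak = ≤-by₂ (ℤ.≤-trans (ℤ.+-monoˡ-≤ 1ℤ (bot≤top r j)) (above r k≤r r⁺<n j (ℕ.<⇒≤ j<r)))
        (ℤ.+-mono-≤ (0≤bit (binary r j)) (ℤ.neg-mono-≤ (bit≤1 (binary (suc r) j))))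
        (eq (bot s r j) (bot s (suc r) j) (bits s r j) (bits s (suc r) j) (top-suc s r j) (top-suc s (suc r) j))
        where
        eq : ∀ x y β β⁺ {u v} → u ≡ x - β → v ≡ y - β⁺ → v - u ≡ y - (x + 1ℤ) + ((β + (- β⁺)) - (0ℤ + (- 1ℤ)))
        eq x y β β⁺ refl refl = solve (x ∷ y ∷ β ∷ β⁺ ∷ [])

  ordered⇒pathfam : Ordered n k s → Pathfamₖ n k s
  ordered⇒pathfam O = record
    { pathfam    = record
      { B-strictlyLower = λ i j i≤j → trans (sym (entry-lookup B i j)) (O.b-lower (toℕ i) (toℕ j) i≤j)
      ; B-binary        = λ i j → subst Binary (entry-lookup B i j) (O.binary (toℕ i) (toℕ j))
      ; D-weaklyLower   = λ i j i<j → trans (sym (entry-lookup D i j)) (O.d-lower (toℕ i) (toℕ j) i<j)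
      ; D-natural       = λ i j → subst (0ℤ ≤_) (entry-lookup D i j) (O.d-nonneg (toℕ i) (toℕ j))
      }
    ; family     = family
    ; encodes    = record
      { B-entries = λ i j j<i → Data.Sum.map
          (λ (p , e) → p , trans (sym (entry-lookup B i j)) e) (λ (p , e) → p , trans (sym (entry-lookup B i j)) e)
          (T.crosses i (toℕ j) z≤n j<i)
      ; D-entries = λ i j j≤i → trans (sym (entry-lookup D i j))
          (trans (sym (w≡ (toℕ i) (toℕ j))) (cong +_ (sym (verticals i (toℕ j) j≤i))))
      }
    ; noVertical = λ i j j<k j<i → trans (sym (entry-lookup D i j)) (O.noVertical (toℕ i) (toℕ j) j<k j<i)
    ; disjoint   = disjoint
    }
    where
    module O = Ordered O
    B = proj₁ s
    D = proj₂ s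

    w : ℕ → ℕ → ℕ
    w r j = ∣ drops s r j ∣

    w≡ : ∀ r j → + w r j ≡ drops s r j
    w≡ r j = ℤ.0≤i⇒+∣i∣≡i (O.d-nonneg r j)

    bot≡ : ∀ r j → bot s r j ≡ top s r j - + w r j
    bot≡ r j = cong (λ v → top s r j - v) (sym (w≡ r j))

    ends : ∀ r → r ℕ.< n → 0ℤ ≡ bot s r r
    ends r r<n = eq (fall s r r) (drops s r r) (O.b-lower r r ℕ.≤-refl) (O.total r r<n)
      where
      eq : ∀ f δ {p β} → β ≡ 0ℤ → f + (β + δ) ≡ p → 0ℤ ≡ p - f - δ
      eq f δ refl refl = solve (f ∷ δ ∷ [])

    traced : ∀ (i : Fin n) → ∃[ P ] Traces (bits s (toℕ i)) (top s (toℕ i)) (bot s (toℕ i)) (w (toℕ i))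
               (O.binary (toℕ i)) (bot≡ (toℕ i)) (top-suc s (toℕ i)) (toℕ i)
               {+ toℕ i , 0ℤ} {0ℤ , + toℕ i} P 0 (w (toℕ i) 0)
    traced i = trace _ _ _ (w (toℕ i)) (O.binary (toℕ i)) (bot≡ (toℕ i)) (top-suc s (toℕ i))
      (ends (toℕ i) (toℕ<n i)) (toℕ i) (w (toℕ i) 0) 0 (+ toℕ i) refl
      (trans (cong (_- + w (toℕ i) 0) (sym (ℤ.+-identityʳ (+ toℕ i)))) (sym (bot≡ (toℕ i) 0)))
      (ℤ.≤-reflexive (sym (ℤ.+-identityʳ (+ toℕ i))))

    family : Family n
    family i = proj₁ (traced i)

    module T i = Traces (proj₂ (traced i))

    verticals : ∀ i j → j ℕ.≤ toℕ i → verticalSteps (family i) (+ j) ≡ w (toℕ i) j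
    verticals i zero    _   = T.vertical₀ i
    verticals i (suc j) j≤i = T.verticals i (suc j) ℕ.z<s j≤i

    -- `Ordered` compares neighbouring rows only. Distant rows are reached by chaining through the
    -- intervals of the t rows between them.
    above : ∀ t r j → k ℕ.≤ r → suc r ℕ.+ t ℕ.< n → j ℕ.≤ r → top s r j + 1ℤ ≤ bot s (suc r ℕ.+ t) j
    above zero r j k≤r r⁺<n j≤r = subst (λ r′ → top s r j + 1ℤ ≤ bot s r′ j) (sym (ℕ.+-identityʳ (suc r)))
      (≤-by₁ (O.order r j k≤r (subst (ℕ._< n) (ℕ.+-identityʳ (suc r)) r⁺<n) j≤r)
        (eq (+ r) (fall s r j) (fall s (suc r) j) (drops s (suc r) j) (+suc r)))
      where
      eq : ∀ p f f⁺ δ⁺ {p⁺} → p⁺ ≡ p + 1ℤ → p⁺ - f⁺ - δ⁺ - (p - f + 1ℤ) ≡ f - (f⁺ + δ⁺)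
      eq p f f⁺ δ⁺ refl = solve (p ∷ f ∷ f⁺ ∷ δ⁺ ∷ [])
    above (suc t) r j k≤r r⁺<n j≤r = subst (λ r′ → top s r j + 1ℤ ≤ bot s r′ j) (sym (ℕ.+-suc (suc r) t))
      (≤-by₂ (ℤ.≤-trans (above 0 r j k≤r (subst (ℕ._< n) (sym (ℕ.+-identityʳ (suc r))) r⁺′<n) j≤r)
                       (subst (λ r′ → bot s r′ j ≤ top s (suc r) j) (sym (ℕ.+-identityʳ (suc r))) bot≤top))
        (ℤ.≤-trans (ℤ.i≤i+j (top s (suc r) j) 1ℤ)
          (above t (suc r) j (ℕ.m≤n⇒m≤1+n k≤r) (subst (ℕ._< n) (ℕ.+-suc (suc r) t) r⁺<n) (ℕ.m≤n⇒m≤1+n j≤r)))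
        (eq (top s r j + 1ℤ) (top s (suc r) j) (bot s (suc (suc r) ℕ.+ t) j)))
      where
      r⁺′<n : suc r ℕ.< n
      r⁺′<n = ℕ.≤-<-trans (ℕ.m≤m+n (suc r) (suc t)) r⁺<n
      bot≤top : bot s (suc r) j ≤ top s (suc r) j
      bot≤top = nonneg⇒bot≤top s (suc r) j (O.d-nonneg (suc r) j)
      eq : ∀ x y z → z - x ≡ (y - x) + (z - y)
      eq x y z = solve (x ∷ y ∷ z ∷ [])

    -- In its column a common point would lie no higher than the top of path i and no lower than the
    -- bottom of path i′, which `above` separates.
    disjoint-< : ∀ i i′ → k ℕ.≤ toℕ i → toℕ i ℕ.< toℕ i′ → ∀ p → ¬ (p ∈ support (family i) × p ∈ support (family i′))
    disjoint-< i i′ k≤i i<i′ p (mem , mem′)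
      with j , c≡ , j≤i , _ , z≤top ← T.within i mem | j′ , c≡′ , _ , bot≤z , _ ← T.within i′ mem′
      with refl ← ℤ.+-injective (trans (sym c≡) c≡′) =
      1+≰ (ℤ.≤-trans (subst (λ r → top s (toℕ i) j + 1ℤ ≤ bot s r j) i′≡
            (above (toℕ i′ ℕ.∸ suc (toℕ i)) (toℕ i) j k≤i (subst (ℕ._< n) (sym i′≡) (toℕ<n i′)) j≤i))
          (ℤ.≤-trans bot≤z z≤top))
      where
      i′≡ : suc (toℕ i) ℕ.+ (toℕ i′ ℕ.∸ suc (toℕ i)) ≡ toℕ i′
      i′≡ = ℕ.m+[n∸m]≡n i<i′

    disjoint : ∀ i i′ → k ℕ.≤ toℕ i → k ℕ.≤ toℕ i′ → i ≢ i′ →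
               ∀ p → ¬ (p ∈ support (family i) × p ∈ support (family i′))
    disjoint i i′ k≤i k≤i′ i≢i′ p with ℕ.<-cmp (toℕ i) (toℕ i′)
    ... | tri< i<i′ _ _ = disjoint-< i i′ k≤i i<i′ p
    ... | tri≈ _ i≡i′ _ = contradiction (toℕ-injective i≡i′) i≢i′
    ... | tri> _ _ i>i′ = disjoint-< i′ i k≤i′ i>i′ p ∘ Data.Product.swap

-- The two inner loops as mutually inverse bijections

module _ {m} (k : Fin (suc m)) where
  private
    κ = toℕ k

    κ≤m : κ ℕ.≤ m
    κ≤m = ℕ.s≤s⁻¹ (toℕ<n k)

  comb : ∀ x → Pathfamₖ (suc m) (suc κ) x → Chain κ κ x (combLoop k x)
  comb x F = comb-chain k (m ℕ.∸ κ) κ (ℕ.m+[n∸m]≡n κ≤m) ℕ.≤-refl x (Ordered.binary O)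
               (ordered⇒invariant-first (toℕ<n k) O)
    where O = pathfam⇒ordered F

  comb-pathfam : ∀ x → Pathfamₖ (suc m) (suc κ) x → Pathfamₖ (suc m) κ (combLoop k x)
  comb-pathfam x F = ordered⇒pathfam (invariant-last⇒ordered
    (base-frame (chain-frame ℕ.≤-refl (comb x F)) (ordered⁺⇒base O))
    (chain-invariant ℕ.≤-refl (comb x F) (ordered⇒invariant-first (toℕ<n k) O)))
    where O = pathfam⇒ordered F

  module _ (y : Pair (suc m)) (F : Pathfamₖ (suc m) κ y) (h : Vec ℤ (suc m)) (init : InitialHeights k y h) where
    private
      O = pathfam⇒ordered F

      heights : 0 ℕ.< κ → ∀ r → κ ℕ.≤ r → r ℕ.≤ m → at h r ≡ + r - prefix (bits y r) (κ ℕ.∸ 1)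
      heights 0<κ r κ≤r r≤m with c ← fromℕ< (s≤s r≤m) | refl ← sym (toℕ-fromℕ< (s≤s r≤m)) =
        trans (at-lookup h c) (trans (init 0<κ c κ≤r)
          (cong (λ z → + toℕ c - z) (sumOver-below (λ j → proj₁ y ⟨ c , j ⟩) (bits y (toℕ c))
            (λ j → sym (entry-lookup (proj₁ y) c j)) (κ ℕ.∸ 1) (ℕ.≤-trans (ℕ.m∸n≤m κ 1) (ℕ.<⇒≤ (toℕ<n k))))))

      module R = Uncomb.Reached (Uncomb.reached k y h (Ordered.binary O) (ordered⇒invariant-last O) heights
                   (m ℕ.∸ κ) κ (ℕ.m+[n∸m]≡n κ≤m) ℕ.≤-refl)

    uncomb : Chain κ κ (proj₁ (uncombLoop k (y , h))) y
    uncomb = R.chain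

    uncomb-pathfam : Pathfamₖ (suc m) (suc κ) (proj₁ (uncombLoop k (y , h)))
    uncomb-pathfam = ordered⇒pathfam (invariant-first⇒ordered (toℕ<n k)
      (base-frame (frame-sym (chain-frame ℕ.≤-refl R.chain)) (ordered⇒base O)) R.invariant)

proposition5p2 : (n : ℕ) (k : Fin n)
    (h₀ : Pair n → Vec ℤ n) →
    (∀ x → Pathfamₖ n (toℕ k) x → InitialHeights k x (h₀ x)) →
    Σ[ φ ∈ Inverse (PathfamSetoid n (suc (toℕ k))) (PathfamSetoid n (toℕ k)) ]
    (∀ x → proj₁ (Inverse.to φ x) ≡ combLoop k (proj₁ x)) ×
    (∀ y → proj₁ (Inverse.from φ y) ≡ proj₁ (uncombLoop k (proj₁ y , h₀ (proj₁ y))))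
proposition5p2 (suc m) k h₀ init = φ , (λ _ → refl) , (λ _ → refl)
  where
  uncombed : Pair (suc m) → Pair (suc m)
  uncombed y = proj₁ (uncombLoop k (y , h₀ y))

  φ : Inverse (PathfamSetoid (suc m) (suc (toℕ k))) (PathfamSetoid (suc m) (toℕ k))
  φ = record
    { to        = λ (x , F) → combLoop k x , comb-pathfam k x F
    ; from      = λ (y , F) → uncombed y , uncomb-pathfam k y F (h₀ y) (init y F)
    ; to-cong   = cong (combLoop k)
    ; from-cong = cong uncombed
    ; inverse   =
        -- Both chains start at the uncombed pair, so their ends agree.
        (λ { {y , F} refl → sym (chain-functional (uncomb k y F (h₀ y) (init y F))
               (comb k (uncombed y) (uncomb-pathfam k y F (h₀ y) (init y F)))) })
      -- Both chains end at the combed pair, so their starts agree.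
      , (λ { {x , F} refl → chain-cofunctional
               (uncomb k (combLoop k x) (comb-pathfam k x F) (h₀ (combLoop k x)) (init (combLoop k x) (comb-pathfam k x F)))
               (comb k x F) })
    }
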